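{- Let $\mathbf{u}$ be an infinite word over a finite alphabet whose language $\mathcal{L}(\mathbf{u})$ is closed under reversal. Then $\mathbf{u}$ is rich if and only if every bispecial factor $w$ of $\mathbf{u}$ satisfies: (1) if $w$ is not a palindrome, then $\mathrm{b}(w)=0$; (2) if $w$ is a palindrome, then $\mathrm{b}(w)=\#\mathrm{Pext}(w)-1$.
   Context: An infinite word over a finite alphabet $\mathcal{A}$ is a one-sided infinite sequence $\mathbf{u}=u_0u_1u_2\ldots$ of letters of $\mathcal{A}$ in which every letter of $\mathcal{A}$ occurs. Its language $\mathcal{L}(\mathbf{u})$ is the set of all its finite factors (contiguous subwords), including the empty word $\varepsilon$. The reversal of $w=w_0\cdots w_{n-1}$ is $\overline{w}=w_{n-1}\cdots w_0$; $w$ is a palindrome if $w=\overline{w}$ (the empty word is a palindrome). $\mathcal{L}(\mathbf{u})$ is closed under reversal if $w\in\mathcal{L}(\mathbf{u})$ implies $\overline{w}\in\mathcal{L}(\mathbf{u})$. For $w\in\mathcal{L}(\mathbf{u})$: $\mathrm{Lext}(w)=\{a\in\mathcal{A}: aw\in\mathcal{L}(\mathbf{u})\}$, $\mathrm{Rext}(w)=\{a\in\mathcal{A}: wa\in\mathcal{L}(\mathbf{u})\}$, $\mathrm{Bext}(w)=\{awb\in\mathcal{L}(\mathbf{u}): a,b\in\mathcal{A}\}$. A factor $w$ is bispecial if $\#\mathrm{Lext}(w)\ge 2$ and $\#\mathrm{Rext}(w)\ge 2$. The bilateral order of $w$ is $\mathrm{b}(w)=\#\mathrm{Bext}(w)-\#\mathrm{Rext}(w)-\#\mathrm{Lext}(w)+1$.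 For a palindrome $w$, $\mathrm{Pext}(w)=\{awa\in\mathcal{L}(\mathbf{u}): a\in\mathcal{A}\}$. $\mathbf{u}$ is rich if every factor $w$ of $\mathbf{u}$ contains exactly $|w|+1$ distinct palindromic factors (including the empty word). -}

module Defs where

open import Data.Fin using (Fin)
open import Data.Integer as ℤ using (ℤ; +_)
open import Data.List using (List; []; _∷_; _∷ʳ_; length; reverse; applyUpTo; allFin; cartesianProductWith)
open import Data.List.Membership.Propositional using (_∈_)
open import Data.List.Membership.Propositional.Properties using (∈-allFin; ∈-cartesianProductWith⁺)
open import Data.List.Membership.Propositional.Properties.WithK using (unique∧set⇒bag)
open import Data.List.Relation.Binary.BagAndSetEquality using (∼bag⇒↭)
open import Data.List.Relation.Binary.Infix.Heterogeneous using (Infix)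
open import Data.List.Relation.Binary.Permutation.Propositional.Properties using (↭-length)
open import Data.List.Relation.Unary.All.Properties using (¬Any⇒All¬)
open import Data.List.Relation.Unary.Any using (here; there)
open import Data.List.Relation.Unary.AllPairs using ([]; _∷_)
open import Data.List.Relation.Unary.Unique.Propositional using (Unique)
open import Data.Nat using (ℕ; _+_; _≤_)
open import Data.Product using (∃; ∃-syntax; _×_; _,_; proj₂)
open import Function using (_⇔_; mk⇔; Equivalence)
open import Function.Definitions using (StrictlySurjective)
open import Function.Properties.Equivalence using (⇔-isEquivalence)
open import Relation.Binary.PropositionalEquality using (_≡_; refl)
open import Relation.Binary.Structures using (IsEquivalence)
open import Relation.Nullary using (¬_; yes; no; contradiction)
open import Relation.Nullary.Decidable using (¬¬-excluded-middle)
open import Relation.Unary using (Pred)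
open import Level using (0ℓ)

-- `Card P n` says #{x : P x} = n.  Cardinality is a relation rather than a
-- function because membership in the language of an infinite word is not
-- decidable.  `card-unique` shows that it is single-valued; `¬¬-card` shows
-- that, up to double negation, every set contained in a list has one.

Card : {X : Set} → Pred X 0ℓ → ℕ → Set
Card P n = ∃[ xs ] (Unique xs × (∀ x → x ∈ xs ⇔ P x) × length xs ≡ n)

card-unique : {X : Set} {P : Pred X 0ℓ} {m n : ℕ} → Card P m → Card P n → m ≡ n
card-unique (xs , !xs , xs⇔P , refl) (ys , !ys , ys⇔P , refl) =
  ↭-length (∼bag⇒↭ (unique∧set⇒bag !xs !ys
    (λ {x} → E.trans (xs⇔P x) (E.sym (ys⇔P x)))))
  where module E = IsEquivalence (⇔-isEquivalence {0ℓ})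

¬¬-card : {X : Set} {P : Pred X 0ℓ} (xs : List X) → (∀ {x} → P x → x ∈ xs) →
          ¬ ¬ ∃ (Card P)
¬¬-card {X} {P} xs P⊆xs none = select xs λ (ys , !ys , ys⇔) →
  none (length ys , ys , !ys ,
        (λ x → mk⇔ (λ x∈ys → proj₂ (Equivalence.to (ys⇔ x) x∈ys))
                   (λ Px → Equivalence.from (ys⇔ x) (P⊆xs Px , Px))) ,
        refl)
  where
  select : ∀ zs → ¬ ¬ (∃[ ys ] (Unique ys × (∀ x → x ∈ ys ⇔ (x ∈ zs × P x))))
  select [] k = k ([] , [] , λ x → mk⇔ (λ ()) (λ ()))
  select (z ∷ zs) k = select zs λ (ys , !ys , ys⇔) →
    let
      weaken : ∀ {x} → x ∈ ys → x ∈ z ∷ zs × P x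
      weaken {x} x∈ys = let (x∈zs , Px) = Equivalence.to (ys⇔ x) x∈ys in there x∈zs , Px
    in
    ¬¬-excluded-middle {A = P z} λ where
      (no ¬Pz) → k (ys , !ys , λ x → mk⇔ weaken λ where
        (here refl , Px)  → contradiction Px ¬Pz
        (there x∈zs , Px) → Equivalence.from (ys⇔ x) (x∈zs , Px))
      (yes Pz) → ¬¬-excluded-middle {A = z ∈ ys} λ where
        (yes z∈ys) → k (ys , !ys , λ x → mk⇔ weaken λ where
          (here refl , Px)  → z∈ys
          (there x∈zs , Px) → Equivalence.from (ys⇔ x) (x∈zs , Px))
        (no z∉ys) → k (z ∷ ys , ¬Any⇒All¬ ys z∉ys ∷ !ys , λ x → mk⇔
          (λ { (here refl) → here refl , Pz ; (there x∈ys) → weaken x∈ys })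
          (λ { (here refl , Px)  → here refl
             ; (there x∈zs , Px) → there (Equivalence.from (ys⇔ x) (x∈zs , Px)) }))

record InfiniteWord (k : ℕ) : Set where
  field
    letter : ℕ → Fin k
    occurs : StrictlySurjective _≡_ letter

open InfiniteWord public

Word : ℕ → Set
Word k = List (Fin k)

Palindrome : ∀ {k} → Pred (Word k) 0ℓ
Palindrome w = w ≡ reverse w

module _ {k : ℕ} (u : InfiniteWord k) where

  Language : Pred (Word k) 0ℓ
  Language w = ∃[ i ] ∃[ n ] w ≡ applyUpTo (λ j → letter u (i + j)) n

  ClosedUnderReversal : Set
  ClosedUnderReversal = ∀ w → Language w → Language (reverse w)

  Lext : Word k → Pred (Fin k) 0ℓ
  Lext w a = Language (a ∷ w)

  Rext : Word k → Pred (Fin k) 0ℓ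
  Rext w a = Language (w ∷ʳ a)

  Bext : Word k → Pred (Word k) 0ℓ
  Bext w v = ∃[ a ] ∃[ b ] (v ≡ a ∷ (w ∷ʳ b) × Language v)

  Pext : Word k → Pred (Word k) 0ℓ
  Pext w v = ∃[ a ] (v ≡ a ∷ (w ∷ʳ a) × Language v)

  Bispecial : Pred (Word k) 0ℓ
  Bispecial w = Language w
              × (∃[ l ] (Card (Lext w) l × 2 ≤ l))
              × (∃[ r ] (Card (Rext w) r × 2 ≤ r))

  -- `BilateralOrder w z` says b(w) = z.  The relation is single-valued and, up
  -- to double negation, total (see below), so an equation b(w) = c can be
  -- stated as: every z with `BilateralOrder w z` satisfies z ≡ c.
  BilateralOrder : Word k → Pred ℤ 0ℓ
  BilateralOrder w z = ∃[ b ] ∃[ r ] ∃[ l ]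
    (Card (Bext w) b × Card (Rext w) r × Card (Lext w) l ×
     z ≡ + b ℤ.- + r ℤ.- + l ℤ.+ + 1)

  Rich : Set
  Rich = ∀ w → Language w →
    Card (λ v → Infix _≡_ v w × Palindrome v) (length w + 1)

  bilateralOrder-unique : ∀ {w y z} → BilateralOrder w y → BilateralOrder w z → y ≡ z
  bilateralOrder-unique (_ , _ , _ , B , R , L , refl) (_ , _ , _ , B′ , R′ , L′ , refl)
    with refl ← card-unique B B′ | refl ← card-unique R R′ | refl ← card-unique L L′ = refl

  ¬¬-bilateralOrder : ∀ w → ¬ ¬ ∃ (BilateralOrder w)
  ¬¬-bilateralOrder w none =
    ¬¬-card {P = Bext w} (cartesianProductWith (λ a b → a ∷ (w ∷ʳ b)) (allFin k) (allFin k))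
      (λ { (a , b , refl , _) →
           ∈-cartesianProductWith⁺ (λ a b → a ∷ (w ∷ʳ b)) (∈-allFin a) (∈-allFin b) }) λ (b , B) →
    ¬¬-card {P = Rext w} (allFin k) (λ {a} _ → ∈-allFin a) λ (r , R) →
    ¬¬-card {P = Lext w} (allFin k) (λ {a} _ → ∈-allFin a) λ (l , L) →
    none (_ , b , r , l , B , R , L , refl)

{-# OPTIONS --safe #-}
module Submission where

-- Write {w} for the pair of a word and its reversal.  Richness is equivalent to the following
-- property for all n ("Mirroring n" below): if {w} with |w| = n occurs at position i and next at
-- position j + 1, then the two occurrences are mirror images of each other, together with the
-- letter following the first and the letter preceding the second.  Indeed every prefix of a rich
-- word has a palindromic suffix that does not occur earlier, which forces return words of this
-- kind to be palindromes; conversely, applying the property to longer and longer words shows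
-- that the complete returns of a palindrome are palindromes.
--
-- Fix w of length n and consider the graph with vertices {aw}, {wb} and an edge for each {awb}.
-- By Mirroring n, the successive occurrences of {w} describe a walk in this graph, which is thus
-- connected.  Its Euler characteristic, counted along the walk, shows that the condition on b(w)
-- says exactly that, loops aside, the graph is a tree: a new edge always leads to a new vertex.
-- In a tree, a first return to the vertex {aw} uses the edge of departure, which is
-- Mirroring (n + 1) for the word aw, so the condition on b(w) yields Mirroring n for all n by
-- induction; conversely, Mirroring (n + 1) excludes cycles.

open import Defs
import Algebra.Construct.NaturalChoice.Min as NaturalChoice
open import Data.Empty using (⊥; ⊥-elim)
open import Data.Fin using (Fin)
import Data.Fin.Properties as Fin
open import Data.Integer using (0ℤ; 1ℤ; +_; _-_)
import Data.Integer as ℤ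
import Data.Integer.Properties as ℤ
import Data.Integer.Tactic.RingSolver as ℤ
open import Data.List using (List; []; _∷_; _∷ʳ_; _++_; length; map; reverse; take; drop; applyUpTo; allFin)
open import Data.List.Properties using (≡-dec; ∷-injectiveˡ; ∷-injectiveʳ; ∷ʳ-injectiveˡ; ∷ʳ-injectiveʳ;
  length-++; length-++-sucʳ; length-map; length-applyUpTo; length-reverse;
  reverse-++; reverse-involutive; unfold-reverse)
open import Data.List.Membership.Propositional using (_∈_; find; lose)
import Data.List.Membership.DecPropositional as DecMembership
open import Data.List.Membership.Propositional.Properties
open import Data.List.Relation.Binary.Infix.Heterogeneous using (Infix; here; there)
import Data.List.Relation.Binary.Lex.NonStrict as Lex
open import Data.List.Relation.Binary.Pointwise using (Pointwise-≡⇒≡)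
open import Data.List.Relation.Binary.Prefix.Heterogeneous using (Prefix; []; _∷_)
open import Data.List.Relation.Unary.All using (lookup; []; _∷_)
open import Data.List.Relation.Unary.All.Properties using (¬Any⇒All¬)
open import Data.List.Relation.Unary.AllPairs using ([]; _∷_)
open import Data.List.Relation.Unary.Any using (here; there; any?)
open import Data.List.Relation.Unary.Unique.Propositional using (Unique)
open import Data.List.Relation.Unary.Unique.Propositional.Properties using (++⁺)
open import Data.Nat using (ℕ; zero; suc; _+_; _*_; _∸_; _≤_; _<_; z≤n; s≤s; _≤?_)
open import Data.Nat.Properties
open import Data.Nat.Tactic.RingSolver using (solve-∀)
open import Data.Product using (∃-syntax; _×_; _,_; proj₁; proj₂; swap)
open import Data.Product.Properties using (,-injectiveˡ; ,-injectiveʳ) renaming (≡-dec to ×-≡-dec)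
open import Data.Sum using (_⊎_; inj₁; inj₂; [_,_]′)
open import Data.Unit using (⊤; tt)
open import Function using (_⇔_; mk⇔; Equivalence; _∘_; id)
open import Level using (0ℓ)
open import Relation.Binary using (DecTotalOrder; DecidableEquality)
open import Relation.Binary.PropositionalEquality
open import Relation.Nullary using (¬_; Dec; yes; no; contradiction; _⊎-dec_; _×-dec_; _→-dec_)
open import Relation.Nullary.Decidable using (¬?; decidable-stable)
open import Relation.Unary using (Pred; Decidable)
open Equivalence using (to; from)

-- Cardinalities

card-resp : ∀ {X : Set} {P Q : Pred X 0ℓ} {n} → (∀ x → P x ⇔ Q x) → Card P n → Card Q n
card-resp P⇔Q (xs , !xs , xs⇔ , eq) = xs , !xs ,
  (λ x → mk⇔ (λ x∈ → to (P⇔Q x) (to (xs⇔ x) x∈)) (λ q → from (xs⇔ x) (from (P⇔Q x) q))) , eq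

card-empty : ∀ {X : Set} {P : Pred X 0ℓ} → (∀ x → ¬ P x) → Card P 0
card-empty ¬P = [] , [] , (λ x → mk⇔ (λ ()) (λ p → ⊥-elim (¬P x p))) , refl

card-suc : ∀ {X : Set} {P Q : Pred X 0ℓ} {n} z → ¬ P z → (∀ x → Q x ⇔ (P x ⊎ x ≡ z)) →
  Card P n → Card Q (suc n)
card-suc z ¬Pz Q⇔ (xs , !xs , xs⇔ , eq) =
  z ∷ xs , ¬Any⇒All¬ xs (λ z∈ → ¬Pz (to (xs⇔ z) z∈)) ∷ !xs ,
  (λ x → mk⇔ (λ { (here p) → from (Q⇔ x) (inj₂ p)
                ; (there p) → from (Q⇔ x) (inj₁ (to (xs⇔ x) p)) })
             (λ q → case (to (Q⇔ x) q))) , cong suc eq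
  where
  case : ∀ {x} → _ ⊎ x ≡ z → x ∈ z ∷ xs
  case (inj₁ p) = there (from (xs⇔ _) p)
  case (inj₂ p) = here p

card-⊎ : ∀ {X : Set} {P Q : Pred X 0ℓ} {m n} → (∀ x → P x → ¬ Q x) →
  Card P m → Card Q n → Card (λ x → P x ⊎ Q x) (m + n)
card-⊎ disj (xs , !xs , xs⇔ , refl) (ys , !ys , ys⇔ , refl) =
  xs ++ ys , ++⁺ !xs !ys (λ {x} (x∈ , y∈) → disj x (to (xs⇔ x) x∈) (to (ys⇔ x) y∈)) ,
  (λ x → mk⇔ (λ x∈ → fwd (∈-++⁻ xs x∈))
             λ { (inj₁ p) → ∈-++⁺ˡ (from (xs⇔ x) p) ; (inj₂ q) → ∈-++⁺ʳ xs (from (ys⇔ x) q) }) ,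
  length-++ xs
  where
  fwd : ∀ {x} → x ∈ xs ⊎ x ∈ ys → _
  fwd (inj₁ p) = inj₁ (to (xs⇔ _) p)
  fwd (inj₂ p) = inj₂ (to (ys⇔ _) p)

Image : ∀ {X Y : Set} → (X → Y) → Pred X 0ℓ → Pred Y 0ℓ
Image f P y = ∃[ x ] (P x × y ≡ f x)

Unique-map⁺ : ∀ {X Y : Set} {f : X → Y} xs → (∀ x y → x ∈ xs → y ∈ xs → f x ≡ f y → x ≡ y) →
  Unique xs → Unique (map f xs)
Unique-map⁺ []       inj []          = []
Unique-map⁺ {f = f} (x ∷ xs) inj (x∉ ∷ !xs) =
  ¬Any⇒All¬ (map f xs) (λ fx∈ → let (y , y∈ , eq) = ∈-map⁻ f fx∈ in
    lookup x∉ y∈ (inj x y (here refl) (there y∈) eq)) ∷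
  Unique-map⁺ xs (λ y z y∈ z∈ → inj y z (there y∈) (there z∈)) !xs

card-image : ∀ {X Y : Set} {P : Pred X 0ℓ} {n} (f : X → Y) →
  (∀ x y → P x → P y → f x ≡ f y → x ≡ y) → Card P n → Card (Image f P) n
card-image f inj (xs , !xs , xs⇔ , eq) =
  map f xs , Unique-map⁺ xs (λ x y x∈ y∈ → inj x y (to (xs⇔ x) x∈) (to (xs⇔ y) y∈)) !xs ,
  (λ y → mk⇔ (λ y∈ → let (x , x∈ , p) = ∈-map⁻ f y∈ in x , to (xs⇔ x) x∈ , p)
             λ { (x , Px , refl) → ∈-map⁺ f (from (xs⇔ x) Px) }) ,
  trans (length-map f xs) eq

Unique-⊆-length : ∀ {X : Set} {xs ys : List X} → Unique xs → (∀ {x} → x ∈ xs → x ∈ ys) → length xs ≤ length ys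
Unique-⊆-length []          _  = z≤n
Unique-⊆-length {xs = x ∷ xs} (x∉ ∷ !xs) xs⊆ys with ∈-∃++ (xs⊆ys (here refl))
... | as , bs , refl = subst (suc (length xs) ≤_) (sym (length-++-sucʳ as x bs))
  (s≤s (Unique-⊆-length !xs λ {y} y∈ → keep y y∈ (∈-++⁻ as (xs⊆ys (there y∈)))))
  where
  keep : ∀ y → y ∈ xs → y ∈ as ⊎ y ∈ x ∷ bs → y ∈ as ++ bs
  keep y y∈ (inj₁ p)           = ∈-++⁺ˡ p
  keep y y∈ (inj₂ (here refl)) = contradiction refl (lookup x∉ y∈)
  keep y y∈ (inj₂ (there p))   = ∈-++⁺ʳ as p

-- Pigeonhole made effective: `P` itself may be undecidable, but membership in the list enumerating
-- it is not, so the list of `Q` can be searched.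
card-<⇒∃ : ∀ {X : Set} {P Q : Pred X 0ℓ} {m n} → DecidableEquality X → m < n → Card P m → Card Q n →
  ∃[ x ] (Q x × ¬ P x)
card-<⇒∃ {X} {P} {Q} _≟_ m<n (xs , !xs , xs⇔ , refl) (ys , !ys , ys⇔ , refl) = new (any? (λ y → ¬? (y ∈? xs)) ys)
  where
  open DecMembership _≟_ using (_∈?_)
  new : Dec _ → ∃[ x ] (Q x × ¬ P x)
  new (yes p) = let (y , y∈ , y∉) = find p in y , to (ys⇔ y) y∈ , λ Py → y∉ (from (xs⇔ y) Py)
  new (no ¬p) = contradiction m<n (≤⇒≯ (Unique-⊆-length !ys λ {y} y∈ →
    decidable-stable (y ∈? xs) λ y∉ → ¬p (lose y∈ y∉)))

-- Factors and mirror images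

_≟ʷ_ : ∀ {k} (v w : Word k) → Dec (v ≡ w)
_≟ʷ_ = ≡-dec Fin._≟_

reverse-∷ʳ : ∀ {A : Set} (w : List A) a → reverse (w ∷ʳ a) ≡ a ∷ reverse w
reverse-∷ʳ w a = reverse-++ w (a ∷ [])

reverse-∷-∷ʳ : ∀ {A : Set} a (w : List A) b → reverse (a ∷ (w ∷ʳ b)) ≡ b ∷ (reverse w ∷ʳ a)
reverse-∷-∷ʳ a w b = trans (unfold-reverse a (w ∷ʳ b)) (cong (_∷ʳ a) (reverse-∷ʳ w b))

-- If `reverse w` is `h ∷ t`, then `w` ends in `h`: comparing first letters gives `a ≡ h`, comparing
-- last letters `h ≡ b`.
∷≡reverse∷ʳ⇒≡ : ∀ {A : Set} {a b : A} w → a ∷ w ≡ reverse w ∷ʳ b → a ≡ b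
∷≡reverse∷ʳ⇒≡ {a = a} {b} w eq with reverse w in eqʳ
... | []    = ∷-injectiveˡ eq
... | h ∷ t = trans (∷-injectiveˡ eq)
  (∷ʳ-injectiveʳ (reverse t) t (trans (sym w≡) (∷-injectiveʳ eq)))
  where
  w≡ : w ≡ reverse t ∷ʳ h
  w≡ = trans (sym (reverse-involutive w)) (trans (cong reverse eqʳ) (unfold-reverse h t))

-- All letters are equal: `a` must begin `w`, and cancelling it leaves an equation of the same form
-- for the tail of `w`.
∷≡∷ʳ⇒palindrome : ∀ {A : Set} {a b : A} w → a ∷ w ≡ w ∷ʳ b → a ≡ b × w ≡ reverse w
∷≡∷ʳ⇒palindrome []      refl = refl , refl
∷≡∷ʳ⇒palindrome (c ∷ w) eq with refl ← ∷-injectiveˡ eq | eq′ ← ∷-injectiveʳ eq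
  with refl , pal ← ∷≡∷ʳ⇒palindrome w eq′ =
  refl , (begin
    c ∷ w            ≡⟨ cong (c ∷_) pal ⟩
    c ∷ reverse w    ≡⟨ reverse-∷ʳ w c ⟨
    reverse (w ∷ʳ c) ≡⟨ cong reverse eq′ ⟨
    reverse (c ∷ w)  ∎)
  where open ≡-Reasoning

module _ {k : ℕ} where

  private
    module O = DecTotalOrder (Lex.≤-decTotalOrder (Fin.≤-decTotalOrder k))
    module Min = NaturalChoice O.totalOrder

  abstract

    -- The order only serves to choose a representative of {w , reverse w}.
    canonical : Word k → Word k
    canonical w = w Min.⊓ reverse w

    canonical-reverse : ∀ w → canonical (reverse w) ≡ canonical w
    canonical-reverse w = trans (cong (reverse w Min.⊓_) (reverse-involutive w))
                                (Pointwise-≡⇒≡ (Min.⊓-comm (reverse w) w))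

    canonical-sel : ∀ w → canonical w ≡ w ⊎ canonical w ≡ reverse w
    canonical-sel w with Min.⊓-sel w (reverse w)
    ... | inj₁ p = inj₁ (Pointwise-≡⇒≡ p)
    ... | inj₂ p = inj₂ (Pointwise-≡⇒≡ p)

  canonical-≡ : ∀ {v w} → canonical v ≡ canonical w → v ≡ w ⊎ v ≡ reverse w
  canonical-≡ {v} {w} eq with canonical-sel v | canonical-sel w
  ... | inj₁ p | inj₁ q = inj₁ (trans (sym p) (trans eq q))
  ... | inj₁ p | inj₂ q = inj₂ (trans (sym p) (trans eq q))
  ... | inj₂ p | inj₁ q = inj₂ (trans (sym (reverse-involutive v))
                                      (cong reverse (trans (sym p) (trans eq q))))
  ... | inj₂ p | inj₂ q = inj₁ (trans (sym (reverse-involutive v))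
    (trans (cong reverse (trans (sym p) (trans eq q))) (reverse-involutive w)))

  -- Ensures that the letters of `Lext w` give distinct vertices of the graph around `w`.
  canonical-∷-injective : ∀ {a b} w → canonical (a ∷ w) ≡ canonical (b ∷ w) → a ≡ b
  canonical-∷-injective {a} {b} w eq with canonical-≡ eq
  ... | inj₁ p = ∷-injectiveˡ p
  ... | inj₂ p = ∷≡reverse∷ʳ⇒≡ w (trans p (unfold-reverse b w))

  canonical-∷ʳ : ∀ w a → canonical (w ∷ʳ a) ≡ canonical (a ∷ reverse w)
  canonical-∷ʳ w a = trans (sym (canonical-reverse (w ∷ʳ a))) (cong canonical (reverse-∷ʳ w a))

  canonical-∷ʳ-injective : ∀ {a b} w → canonical (w ∷ʳ a) ≡ canonical (w ∷ʳ b) → a ≡ b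
  canonical-∷ʳ-injective w eq = canonical-∷-injective (reverse w)
    (trans (sym (canonical-∷ʳ w _)) (trans eq (canonical-∷ʳ w _)))

  -- Contrapositively, around a non-palindrome the left and the right extensions give disjoint sets
  -- of vertices, and no edge is a loop.
  canonical-∷≡∷ʳ⇒palindrome : ∀ {a b} w → canonical (a ∷ w) ≡ canonical (w ∷ʳ b) → Palindrome w
  canonical-∷≡∷ʳ⇒palindrome {a} {b} w eq with canonical-≡ eq
  ... | inj₁ p = proj₂ (∷≡∷ʳ⇒palindrome w p)
  ... | inj₂ p = ∷-injectiveʳ (trans p (reverse-∷ʳ w b))

module Factors {k : ℕ} (u : ℕ → Fin k) where

  factor : ℕ → ℕ → Word k
  factor i zero    = []
  factor i (suc n) = u i ∷ factor (suc i) n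

  length-factor : ∀ i n → length (factor i n) ≡ n
  length-factor i zero    = refl
  length-factor i (suc n) = cong suc (length-factor (suc i) n)

  factor-∷ʳ : ∀ i n → factor i (suc n) ≡ factor i n ∷ʳ u (i + n)
  factor-∷ʳ i zero    = cong (λ j → u j ∷ []) (sym (+-identityʳ i))
  factor-∷ʳ i (suc n) = cong (u i ∷_) (trans (factor-∷ʳ (suc i) n)
    (cong (λ j → factor (suc i) n ∷ʳ u j) (sym (+-suc i n))))

  applyUpTo-factor : ∀ f i n → (∀ j → f j ≡ u (i + j)) → applyUpTo f n ≡ factor i n
  applyUpTo-factor f i zero    eq = refl
  applyUpTo-factor f i (suc n) eq = cong₂ _∷_ (trans (eq 0) (cong u (+-identityʳ i)))
    (applyUpTo-factor (f ∘ suc) (suc i) n (λ j → trans (eq (suc j)) (cong u (+-suc i j))))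

  factor-pointwise⁻ : ∀ i j n → factor i n ≡ factor j n → ∀ t → t < n → u (i + t) ≡ u (j + t)
  factor-pointwise⁻ i j (suc n) eq zero    _ =
    trans (cong u (+-identityʳ i)) (trans (∷-injectiveˡ eq) (cong u (sym (+-identityʳ j))))
  factor-pointwise⁻ i j (suc n) eq (suc t) (s≤s t<n) = trans (cong u (+-suc i t))
    (trans (factor-pointwise⁻ (suc i) (suc j) n (∷-injectiveʳ eq) t t<n) (cong u (sym (+-suc j t))))

  factor-pointwise⁺ : ∀ i j n → (∀ t → t < n → u (i + t) ≡ u (j + t)) → factor i n ≡ factor j n
  factor-pointwise⁺ i j zero    eq = refl
  factor-pointwise⁺ i j (suc n) eq = cong₂ _∷_
    (trans (cong u (sym (+-identityʳ i))) (trans (eq 0 (s≤s z≤n)) (cong u (+-identityʳ j))))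
    (factor-pointwise⁺ (suc i) (suc j) n λ t t<n → trans (cong u (sym (+-suc i t)))
      (trans (eq (suc t) (s≤s t<n)) (cong u (+-suc j t))))

  -- The reflection x ↦ s - 1 - x preserves letters as long as x ≥ i and its image is ≥ j.
  Mirror : ℕ → ℕ → ℕ → Set
  Mirror i j s = ∀ x y → i ≤ x → j ≤ y → suc (x + y) ≡ s → u x ≡ u y

  Mirror-sym : ∀ {i j s} → Mirror i j s → Mirror j i s
  Mirror-sym m x y j≤x i≤y eq = sym (m y x i≤y j≤x (trans (cong suc (+-comm y x)) eq))

  Mirror-mono : ∀ {i j i′ j′ s} → i ≤ i′ → j ≤ j′ → Mirror i j s → Mirror i′ j′ s
  Mirror-mono i≤ j≤ m x y i′≤x j′≤y = m x y (≤-trans i≤ i′≤x) (≤-trans j≤ j′≤y)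

  -- `s` is tied down by an equation because it stays fixed while the induction drops the first
  -- letter of one factor and the last letter of the other.
  factor≡reverse⇒Mirror : ∀ {i j s} n → s ≡ i + j + n → factor i n ≡ reverse (factor j n) → Mirror i j s
  factor≡reverse⇒Mirror {i} {j} zero refl _ x y i≤x j≤y eq =
    contradiction (trans eq (+-identityʳ (i + j))) (>⇒≢ (s≤s (+-mono-≤ i≤x j≤y)))
  factor≡reverse⇒Mirror {i} {j} (suc n) refl eq x y i≤x j≤y x+y
    with eq′ ← trans eq (trans (cong reverse (factor-∷ʳ j n)) (reverse-∷ʳ (factor j n) (u (j + n))))
    with m≤n⇒m<n∨m≡n i≤x
  ... | inj₁ i<x  = factor≡reverse⇒Mirror n (+-suc (i + j) n) (∷-injectiveʳ eq′) x y i<x j≤y x+y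
  ... | inj₂ refl = trans (∷-injectiveˡ eq′) (cong u (sym (+-cancelˡ-≡ i y (j + n)
    (trans (suc-injective (trans x+y (+-suc (i + j) n))) (+-assoc i j n)))))

  Mirror⇒factor≡reverse : ∀ {i j s} n → s ≡ i + j + n → Mirror i j s → factor i n ≡ reverse (factor j n)
  Mirror⇒factor≡reverse zero eq m = refl
  Mirror⇒factor≡reverse {i} {j} (suc n) refl m = trans
    (cong₂ _∷_ (m i (j + n) ≤-refl (m≤m+n j n) (sym (trans (+-suc (i + j) n) (cong suc (+-assoc i j n)))))
               (Mirror⇒factor≡reverse n (+-suc (i + j) n) (Mirror-mono (n≤1+n i) ≤-refl m)))
    (sym (trans (cong reverse (factor-∷ʳ j n)) (reverse-∷ʳ (factor j n) (u (j + n)))))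

  class : ℕ → ℕ → Word k
  class n i = canonical (factor i n)

  class-≡ : ∀ {n i j} → class n i ≡ class n j → factor i n ≡ factor j n ⊎ Mirror i j (i + j + n)
  class-≡ {n} eq with canonical-≡ eq
  ... | inj₁ p = inj₁ p
  ... | inj₂ p = inj₂ (factor≡reverse⇒Mirror n refl p)

  Mirror⇒class : ∀ {n i j s} → s ≡ i + j + n → Mirror i j s → class n i ≡ class n j
  Mirror⇒class {n} eq m = trans (cong canonical (Mirror⇒factor≡reverse n eq m)) (canonical-reverse _)

  -- Consecutive occurrences of {w , reverse w} are mirror images of each other, including the
  -- letters that follow the first one and precede the second one.
  Mirroring : ℕ → Set
  Mirroring n = ∀ i j → i ≤ j → class n i ≡ class n (suc j) →
    (∀ l → i < l → l ≤ j → class n i ≢ class n l) → Mirror i j (i + suc j + n)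

lastBefore : ∀ {P : ℕ → Set} → Decidable P → ∀ i j → i ≤ j → P i →
  ∃[ l ] (i ≤ l × l ≤ j × P l × (∀ m → l < m → m ≤ j → ¬ P m))
lastBefore {P} P? i j i≤j Pi with P? j
... | yes Pj = j , i≤j , ≤-refl , Pj , λ m j<m m≤j → contradiction m≤j (<⇒≱ j<m)
lastBefore {P} P? i j i≤j Pi | no ¬Pj with m≤n⇒m<n∨m≡n i≤j
... | inj₂ refl = contradiction Pi ¬Pj
lastBefore {P} P? i (suc j) _ Pi | no ¬Pj | inj₁ (s≤s i≤j)
  with lastBefore P? i j i≤j Pi
... | l , i≤l , l≤j , Pl , none = l , i≤l , m≤n⇒m≤1+n l≤j , Pl , none′
  where
  none′ : ∀ m → l < m → m ≤ suc j → ¬ P m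
  none′ m l<m m≤1+j with m≤n⇒m<n∨m≡n m≤1+j
  ... | inj₁ (s≤s m≤j) = none m l<m m≤j
  ... | inj₂ refl      = ¬Pj

-- Richness in terms of return words

first : ∀ {P : ℕ → Set} → Decidable P → ∀ i d → P (i + d) →
  ∃[ l ] (i ≤ l × l ≤ i + d × P l × (∀ m → i ≤ m → P m → l ≤ m))
first {P} P? i d P[i+d] with P? i
... | yes Pi = i , ≤-refl , m≤m+n i d , Pi , λ m i≤m _ → i≤m
first {P} P? i zero P[i+d] | no ¬Pi = contradiction (subst P (+-identityʳ i) P[i+d]) ¬Pi
first {P} P? i (suc d) P[i+d] | no ¬Pi
  with first P? (suc i) d (subst P (+-suc i d) P[i+d])
... | l , i<l , l≤ , Pl , least = l , <⇒≤ i<l , subst (l ≤_) (sym (+-suc i d)) l≤ , Pl , least′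
  where
  least′ : ∀ m → i ≤ m → P m → l ≤ m
  least′ m i≤m Pm with m≤n⇒m<n∨m≡n i≤m
  ... | inj₁ i<m  = least m i<m Pm
  ... | inj₂ refl = contradiction Pm ¬Pi

module Palindromes {k : ℕ} (u : ℕ → Fin k) where

  open Factors u

  Within : ℕ → ℕ → Word k → Set
  Within i n v = ∃[ p ] ∃[ m ] (i ≤ p × p + m ≤ i + n × v ≡ factor p m)

  prefix⁻ : ∀ {v} i n → Prefix _≡_ v (factor i n) → ∃[ m ] (m ≤ n × v ≡ factor i m)
  prefix⁻ i zero    []         = 0 , z≤n , refl
  prefix⁻ i (suc n) []         = 0 , z≤n , refl
  prefix⁻ i (suc n) (refl ∷ p) = let (m , m≤n , eq) = prefix⁻ (suc i) n p in
    suc m , s≤s m≤n , cong (u i ∷_) eq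

  prefix⁺ : ∀ i {m n} → m ≤ n → Prefix _≡_ (factor i m) (factor i n)
  prefix⁺ i z≤n       = []
  prefix⁺ i (s≤s m≤n) = refl ∷ prefix⁺ (suc i) m≤n

  infix⁻ : ∀ {v} i n → Infix _≡_ v (factor i n) → Within i n v
  infix⁻ i zero (here []) = i , 0 , ≤-refl , ≤-refl , refl
  infix⁻ i (suc n) (here p) = let (m , m≤n , eq) = prefix⁻ i (suc n) p in
    i , m , ≤-refl , +-monoʳ-≤ i m≤n , eq
  infix⁻ i (suc n) (there q) = let (p , m , i<p , p+m≤ , eq) = infix⁻ (suc i) n q in
    p , m , <⇒≤ i<p , subst (p + m ≤_) (sym (+-suc i n)) p+m≤ , eq

  infix⁺ : ∀ {v} i n → Within i n v → Infix _≡_ v (factor i n)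
  infix⁺ i n (p , m , i≤p , p+m≤ , refl) with m≤n⇒m<n∨m≡n i≤p
  ... | inj₂ refl = here (prefix⁺ i (+-cancelˡ-≤ i m n p+m≤))
  infix⁺ i zero (p , m , i≤p , p+m≤ , refl) | inj₁ i<p =
    contradiction (≤-trans (m≤m+n p m) (≤-trans p+m≤ (≤-reflexive (+-identityʳ i)))) (<⇒≱ i<p)
  infix⁺ i (suc n) (p , m , i≤p , p+m≤ , refl) | inj₁ i<p =
    there (infix⁺ (suc i) n (p , m , i<p , subst (p + m ≤_) (+-suc i n) p+m≤ , refl))

  palindrome⇒Mirror : ∀ {p m e} → p + m ≡ e → Palindrome (factor p m) → Mirror p p (p + e)
  palindrome⇒Mirror {p} {m} refl pal = factor≡reverse⇒Mirror m (sym (+-assoc p p m)) pal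

  Mirror⇒palindrome : ∀ {p m e} → p + m ≡ e → Mirror p p (p + e) → Palindrome (factor p m)
  Mirror⇒palindrome {p} {m} refl mir = Mirror⇒factor≡reverse m (sym (+-assoc p p m)) mir

  RichFactor : ℕ → ℕ → Set
  RichFactor i n = Card (λ v → Within i n v × Palindrome v) (n + 1)

  -- Passing from factor i n to factor i (suc n) creates a palindrome, which is a suffix that
  -- does not occur earlier.
  rich⇒mirroring : (∀ i n → RichFactor i n) → ∀ N → Mirroring N
  rich⇒mirroring rich N i j i≤j same none
    with d , refl ← m≤n⇒∃[o]m+o≡n i≤j
    -- `factor i (suc (d + N))` ends exactly where the second occurrence does; `p` is the start of
    -- the palindrome created by its last letter.
    with v , ((p , m , i≤p , p+m≤ , refl) , pal) , new ←
      card-<⇒∃ _≟ʷ_ (n<1+n (d + N + 1)) (rich i (d + N)) (rich i (suc (d + N)))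
    with m≤n⇒m<n∨m≡n (subst (p + m ≤_) (+-suc i (d + N)) p+m≤)
  ... | inj₁ (s≤s p+m≤′) = ⊥-elim (new ((p , m , i≤p , p+m≤′ , refl) , pal))
  ... | inj₂ p+m≡ with suc (i + d) ≤? p
  -- A palindrome inside the second occurrence also lies in the first, be that a translate or a
  -- mirror image, and so is not new.
  ...   | yes j<p = ⊥-elim (new (earlier (class-≡ same) , pal))
    where
    d′ = proj₁ (m≤n⇒∃[o]m+o≡n j<p)
    p≡ : suc (i + d) + d′ ≡ p
    p≡ = proj₂ (m≤n⇒∃[o]m+o≡n j<p)
    arith : ∀ i d N → suc (i + (d + N)) ≡ suc (i + d) + N
    arith = solve-∀
    N≡ : d′ + m ≡ N
    N≡ = +-cancelˡ-≡ (suc (i + d)) (d′ + m) N (begin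
      suc (i + d) + (d′ + m) ≡⟨ +-assoc (suc (i + d)) d′ m ⟨
      suc (i + d) + d′ + m   ≡⟨ cong (_+ m) p≡ ⟩
      p + m                  ≡⟨ p+m≡ ⟩
      suc (i + (d + N))      ≡⟨ arith i d N ⟩
      suc (i + d) + N        ∎)
      where open ≡-Reasoning
    earlier : factor i N ≡ factor (suc (i + d)) N ⊎ Mirror i (suc (i + d)) (i + suc (i + d) + N) →
      Within i (d + N) (factor p m)
    earlier (inj₁ eq) = i + d′ , m , m≤m+n i d′ ,
      subst (_≤ i + (d + N)) (trans (cong (_+_ i) (sym N≡)) (sym (+-assoc i d′ m))) (+-monoʳ-≤ i (m≤n+m N d)) ,
      sym (factor-pointwise⁺ (i + d′) p m λ t t<m → begin
        u (i + d′ + t)             ≡⟨ cong u (+-assoc i d′ t) ⟩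
        u (i + (d′ + t))           ≡⟨ factor-pointwise⁻ i (suc (i + d)) N eq (d′ + t)
                                        (subst (d′ + t <_) N≡ (+-monoʳ-< d′ t<m)) ⟩
        u (suc (i + d) + (d′ + t)) ≡⟨ cong u (sym (+-assoc (suc (i + d)) d′ t)) ⟩
        u (suc (i + d) + d′ + t)   ≡⟨ cong (λ x → u (x + t)) p≡ ⟩
        u (p + t)                  ∎)
      where open ≡-Reasoning
    earlier (inj₂ mir) = i , m , ≤-refl ,
      +-monoʳ-≤ i (≤-trans (subst (m ≤_) N≡ (m≤n+m m d′)) (m≤n+m N d)) ,
      trans pal (sym (Mirror⇒factor≡reverse m sum (Mirror-mono ≤-refl j<p mir)))
      where
      sum : i + suc (i + d) + N ≡ i + p + m
      sum = trans (+-assoc i (suc (i + d)) N) (trans (cong (_+_ i) (trans (sym (arith i d N)) (sym p+m≡))) (sym (+-assoc i p m)))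
  -- Otherwise the second occurrence is a suffix of the palindrome, whose reflection puts another
  -- occurrence at `p`. Since `i ≤ p ≤ j`, consecutiveness forces `p ≡ i`.
  ...   | no j≮p = subst (Mirror i (i + d)) sum′ (Mirror-mono ≤-refl i≤j (subst (λ x → Mirror x x (x + (p + m))) p≡i mir))
    where
    p≤j : p ≤ i + d
    p≤j = ≤-pred (≰⇒> j≮p)
    mir : Mirror p p (p + (p + m))
    mir = palindrome⇒Mirror refl pal
    arith : ∀ i d N p → p + suc (i + (d + N)) ≡ p + suc (i + d) + N
    arith = solve-∀
    same′ : class N i ≡ class N p
    same′ = trans same (sym (Mirror⇒class (trans (cong (_+_ p) p+m≡) (arith i d N p))
              (Mirror-mono ≤-refl (<⇒≤ (s≤s p≤j)) mir)))
    p≡i : p ≡ i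
    p≡i with m≤n⇒m<n∨m≡n i≤p
    ... | inj₁ i<p = ⊥-elim (none p i<p p≤j same′)
    ... | inj₂ i≡p = sym i≡p
    sum′ : i + (p + m) ≡ i + suc (i + d) + N
    sum′ = trans (cong (_+_ i) p+m≡) (arith i d N i)

  -- Built from the outside inwards: once the first `e + m` letters of the return mirror its last
  -- `e + m`, `Mirroring (e + m)` adds one letter on the inner side. The longer words stay
  -- consecutive, since an occurrence in between, at `x`, would contain the short one at `x` if
  -- translated and at `x + e` if mirrored.
  complete-return : (∀ N → Mirroring N) → ∀ m l j → l ≤ j → class m l ≡ class m (suc j) →
    (∀ x → l < x → x ≤ j → class m l ≢ class m x) → Mirror l l (l + suc j + m)
  complete-return mirroring m l j l≤j same none =
    let (d , l+d≡j) = m≤n⇒∃[o]m+o≡n l≤j in descend d l l+d≡j ≤-refl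
    where
    arith : ∀ l j e m → l + suc (j + e) + m ≡ l + suc j + (e + m)
    arith = solve-∀
    arith′ : ∀ l x e m → l + x + (e + m) ≡ l + (x + e) + m
    arith′ = solve-∀
    s = l + suc j + m
    descend : ∀ e j′ → j′ + e ≡ j → l ≤ j′ → Mirror l j′ s
    descend e j′ refl l≤j′ = subst (Mirror l j′) (sym (arith l j′ e m))
      (mirroring (e + m) l j′ l≤j′ (longer e refl) none′)
      where
      longer : ∀ e′ → e′ ≡ e → class (e′ + m) l ≡ class (e′ + m) (suc j′)
      longer zero     refl = trans same (cong (λ x → class m (suc x)) (+-identityʳ j′))
      longer (suc e′) refl = Mirror⇒class (arith l j′ e m)
        (descend e′ (suc j′) (sym (+-suc j′ e′)) (m≤n⇒m≤1+n l≤j′))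
      none′ : ∀ x → l < x → x ≤ j′ → class (e + m) l ≢ class (e + m) x
      none′ x l<x x≤j′ eq with class-≡ eq
      ... | inj₁ eq′ = none x l<x (≤-trans x≤j′ (m≤m+n j′ e)) (cong canonical
        (factor-pointwise⁺ l x m λ t t<m → factor-pointwise⁻ l x (e + m) eq′ t (≤-trans t<m (m≤n+m m e))))
      ... | inj₂ mir = none (x + e) (≤-trans l<x (m≤m+n x e)) (+-monoˡ-≤ e x≤j′)
        (Mirror⇒class (arith′ l x e m) (Mirror-mono ≤-refl (m≤m+n x e) mir))

  -- Each further letter creates exactly one palindrome, the longest palindromic suffix: an earlier
  -- occurrence of it would lead, by `complete-return`, to a longer palindromic suffix, and its
  -- reflection carries every shorter one to an earlier place.
  mirroring⇒rich : (∀ N → Mirroring N) → ∀ i n → RichFactor i n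
  mirroring⇒rich mirroring i zero = card-suc [] (λ ()) char (card-empty {P = λ _ → ⊥} (λ _ ()))
    where
    char : ∀ v → (Within i 0 v × Palindrome v) ⇔ (⊥ ⊎ v ≡ [])
    char v = mk⇔
      (λ { ((p , zero , _ , _ , eq) , _) → inj₂ eq
         ; ((p , suc m , i≤p , p+m≤ , eq) , _) → contradiction
             (subst₂ _≤_ (+-suc p m) (+-identityʳ i) p+m≤) (<⇒≱ (s≤s (≤-trans i≤p (m≤m+n p m)))) })
      λ { (inj₂ refl) → (i , 0 , ≤-refl , ≤-refl , refl) , refl }
  mirroring⇒rich mirroring i (suc n)
    -- The least start gives the longest suffix; the last letter alone, at `i + n`, guarantees that
    -- the search succeeds.
    with p , i≤p , p≤ , pal , least ←
      first {P = λ p → Palindrome (factor p (i + suc n ∸ p))} (λ p → _ ≟ʷ _) i n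
        (subst (λ m → Palindrome (factor (i + n) m))
          (sym (trans ([m+n]∸[m+o]≡n∸o i (suc n) n) (m+n∸n≡m 1 n))) refl)
    with m , p+m≡ ← m≤n⇒∃[o]m+o≡n (≤-trans p≤ (+-monoʳ-≤ i (n≤1+n n)))
    rewrite trans (cong (_∸ p) (sym p+m≡)) (m+n∸m≡n p m) =
    card-suc (factor p m) (λ (w , _) → fresh w) char (mirroring⇒rich mirroring i n)
    where
    p+m≡′ : p + m ≡ suc (i + n)
    p+m≡′ = trans p+m≡ (+-suc i n)
    longest : ∀ p′ m′ → i ≤ p′ → p′ + m′ ≡ i + suc n → Palindrome (factor p′ m′) → p ≤ p′
    longest p′ m′ i≤p′ eq pal′ = least p′ i≤p′ (subst (λ m → Palindrome (factor p′ m))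
      (sym (trans (cong (_∸ p′) (sym eq)) (m+n∸m≡n p′ m′))) pal′)
    return : ∀ l j → i ≤ l → l ≤ j → suc j ≡ p → class m l ≡ class m p →
      (∀ x → l < x → x ≤ j → ¬ class m x ≡ class m p) → ⊥
    return l j i≤l l≤j refl same none = <⇒≱ (s≤s l≤j)
      (longest l (proj₁ len) i≤l (trans (proj₂ len) p+m≡)
        (Mirror⇒palindrome (proj₂ len) (subst (Mirror l l) (+-assoc l (suc j) m)
          (complete-return mirroring m l j l≤j same λ x l<x x≤j eq → none x l<x x≤j (trans (sym eq) same)))))
      where
      len = m≤n⇒∃[o]m+o≡n (≤-trans (m≤n⇒m≤1+n l≤j) (m≤m+n (suc j) m))
    fresh : ¬ Within i n (factor p m)
    fresh (p′ , m′ , i≤p′ , p′+m′≤ , eq) with refl ← trans (sym (length-factor p m)) (trans (cong length eq) (length-factor p′ m′))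
      with j , j≡ ← m≤n⇒∃[o]m+o≡n (+-cancelʳ-< m p′ p (≤-trans (s≤s p′+m′≤) (≤-reflexive (sym p+m≡′))))
      with l , p′≤l , l≤j , same , none ← lastBefore (λ x → class m x ≟ʷ class m p) p′ (p′ + j) (m≤m+n p′ j) (cong canonical (sym eq)) =
      return l (p′ + j) (≤-trans i≤p′ p′≤l) l≤j j≡ same none
    char : ∀ v → (Within i (suc n) v × Palindrome v) ⇔ ((Within i n v × Palindrome v) ⊎ v ≡ factor p m)
    char v = mk⇔ fwd λ where
        (inj₁ ((p′ , m′ , i≤p′ , ≤n , eq) , pal′)) →
          (p′ , m′ , i≤p′ , ≤-trans ≤n (+-monoʳ-≤ i (n≤1+n n)) , eq) , pal′
        (inj₂ refl) → (p , m , i≤p , ≤-reflexive p+m≡ , refl) , pal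
      where
      fwd : Within i (suc n) v × Palindrome v → (Within i n v × Palindrome v) ⊎ v ≡ factor p m
      fwd ((p′ , m′ , i≤p′ , p′+m′≤ , refl) , pal′) with m≤n⇒m<n∨m≡n p′+m′≤
      ... | inj₁ lt = inj₁ ((p′ , m′ , i≤p′ , ≤-pred (subst (suc (p′ + m′) ≤_) (+-suc i n) lt) , refl) , pal′)
      ... | inj₂ p′+m′≡ with m≤n⇒m<n∨m≡n (longest p′ m′ i≤p′ p′+m′≡ pal′)
      ...   | inj₂ refl = inj₂ (cong (factor p) (+-cancelˡ-≡ p m′ m (trans p′+m′≡ (sym p+m≡))))
      ...   | inj₁ p<p′ = inj₁ ((p , m′ , i≤p ,
                ≤-pred (subst (suc (p + m′) ≤_) (trans p′+m′≡ (+-suc i n)) (+-monoˡ-< m′ p<p′)) ,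
                trans pal′ (sym (Mirror⇒factor≡reverse m′
                  (trans (cong (_+_ p) (trans p+m≡ (sym p′+m′≡))) (sym (+-assoc p p′ m′)))
                  (Mirror-mono ≤-refl (<⇒≤ p<p′) (palindrome⇒Mirror refl pal))))) , pal′)

-- Exploration of a graph along a walk

-- The undirected graph traversed by a walk from x₀, given by the list of its arcs, latest first.
-- Steps may jump, but only to a vertex visited before.
module Exploration {X : Set} (_≟_ : DecidableEquality X) (x₀ : X) where

  Visited : List (X × X) → X → Set
  Visited []             z = z ≡ x₀
  Visited ((_ , y) ∷ es) z = Visited es z ⊎ z ≡ y

  Traversed : List (X × X) → X × X → Set
  Traversed es (x , y) = (x , y) ∈ es ⊎ (y , x) ∈ es

  Connected : List (X × X) → Set
  Connected []             = ⊤
  Connected ((x , _) ∷ es) = Visited es x × Connected es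

  -- On top of Connected, this says that the graph without its loops is a tree.
  Acyclic : List (X × X) → Set
  Acyclic []             = ⊤
  Acyclic ((x , y) ∷ es) = (Visited es y → x ≡ y ⊎ Traversed es (x , y)) × Acyclic es

  visited? : ∀ es z → Dec (Visited es z)
  visited? []             z = z ≟ x₀
  visited? ((_ , y) ∷ es) z = visited? es z ⊎-dec (z ≟ y)

  traversed? : ∀ es e → Dec (Traversed es e)
  traversed? es (x , y) = ((x , y) ∈? es) ⊎-dec ((y , x) ∈? es)
    where open DecMembership (×-≡-dec _≟_ _≟_) using (_∈?_)

  endpoints-visited : ∀ es {x y} → Connected es → (x , y) ∈ es → Visited es x × Visited es y
  endpoints-visited (_ ∷ es) (Vx , conn) (here refl) = inj₁ Vx , inj₂ refl
  endpoints-visited (_ ∷ es) (_ , conn)  (there p)   =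
    let (Vx , Vy) = endpoints-visited es conn p in inj₁ Vx , inj₁ Vy

  traversed-visited : ∀ es {x y} → Connected es → Traversed es (x , y) → Visited es x × Visited es y
  traversed-visited es conn (inj₁ p) = endpoints-visited es conn p
  traversed-visited es conn (inj₂ p) = let (Vy , Vx) = endpoints-visited es conn p in Vx , Vy

  acyclic? : ∀ es → Dec (Acyclic es)
  acyclic? []             = yes tt
  acyclic? ((x , y) ∷ es) =
    (visited? es y →-dec ((x ≟ y) ⊎-dec traversed? es (x , y))) ×-dec acyclic? es

  -- c is the number of independent cycles; a counts every edge twice, except loops.
  EulerCount : List (X × X) → Set
  EulerCount es = ∃[ v ] ∃[ a ] ∃[ l ] ∃[ c ]
    (Card (Visited es) v × Card (Traversed es) a × Card (λ x → (x , x) ∈ es) l ×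
     a + 2 ≡ l + 2 * v + 2 * c × (c ≡ 0 ⇔ Acyclic es))

  private
    old-⇔ : ∀ {P Q : X → Set} {z} → Q z → (∀ x → P x ⇔ (Q x ⊎ x ≡ z)) → ∀ x → Q x ⇔ P x
    old-⇔ {P} {Q} {z} Qz P⇔ x = mk⇔ (from (P⇔ x) ∘ inj₁) (back ∘ to (P⇔ x))
      where
      back : Q x ⊎ x ≡ z → Q x
      back (inj₁ q)    = q
      back (inj₂ refl) = Qz

    bad : ∀ a l v c → a + 2 ≡ l + 2 * v + 2 * c → suc (suc a) + 2 ≡ l + 2 * v + 2 * suc c
    bad a l v c eq = trans (cong (suc ∘ suc) eq) (arith l v c)
      where
      arith : ∀ l v c → suc (suc (l + 2 * v + 2 * c)) ≡ l + 2 * v + 2 * suc c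
      arith = solve-∀

    good : ∀ a l v c → a + 2 ≡ l + 2 * v + 2 * c → suc (suc a) + 2 ≡ l + 2 * suc v + 2 * c
    good a l v c eq = trans (cong (suc ∘ suc) eq) (arith l v c)
      where
      arith : ∀ l v c → suc (suc (l + 2 * v + 2 * c)) ≡ l + 2 * suc v + 2 * c
      arith = solve-∀

  -- A repeated edge changes no count; a new loop adds one to both `a` and `l`; any other new edge
  -- adds two to `a`, balanced by a new vertex or, when it closes a cycle, by an increase of `c`.
  euler : ∀ es → Connected es → EulerCount es
  euler [] _ = 1 , 0 , 0 , 0 ,
    card-suc x₀ (λ ()) (λ x → mk⇔ inj₂ [ ⊥-elim , id ]′) (card-empty {P = λ _ → ⊥} λ _ ()) ,
    card-empty (λ { _ (inj₁ ()) ; _ (inj₂ ()) }) , card-empty (λ _ ()) , refl , mk⇔ (λ _ → tt) (λ _ → refl)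
  euler ((x , y) ∷ es) (Vx , conn)
    with v , a , l , c , V , A , L , eq , c⇔ ← euler es conn | traversed? es (x , y)
  ... | yes t = v , a , l , c ,
    card-resp (old-⇔ (proj₂ (traversed-visited es conn t)) (λ z → mk⇔ id id)) V ,
    card-resp (λ e → mk⇔ [ inj₁ ∘ there , inj₂ ∘ there ]′ back) A ,
    card-resp (λ z → mk⇔ there loop) L , eq ,
    mk⇔ (λ c≡0 → (λ _ → inj₂ t) , to c⇔ c≡0) (from c⇔ ∘ proj₂)
    where
    back : ∀ {e} → Traversed ((x , y) ∷ es) e → Traversed es e
    back (inj₁ (here refl)) = t
    back (inj₁ (there p))   = inj₁ p
    back (inj₂ (here refl)) = [ inj₂ , inj₁ ]′ t
    back (inj₂ (there p))   = inj₂ p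
    loop : ∀ {z} → (z , z) ∈ (x , y) ∷ es → (z , z) ∈ es
    loop (here refl) = [ id , id ]′ t
    loop (there p)   = p
  ... | no ¬t with x ≟ y
  ...   | yes refl = v , suc a , suc l , c ,
    card-resp (old-⇔ Vx (λ z → mk⇔ id id)) V ,
    card-suc (x , x) ¬t (λ e → mk⇔ split join) A ,
    card-suc x (¬t ∘ inj₁) (λ z → mk⇔ splitˡ joinˡ) L ,
    cong suc eq ,
    mk⇔ (λ c≡0 → (λ _ → inj₁ refl) , to c⇔ c≡0) (from c⇔ ∘ proj₂)
    where
    split : ∀ {e} → Traversed ((x , x) ∷ es) e → Traversed es e ⊎ e ≡ (x , x)
    split (inj₁ (here refl)) = inj₂ refl
    split (inj₁ (there p))   = inj₁ (inj₁ p)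
    split (inj₂ (here refl)) = inj₂ refl
    split (inj₂ (there p))   = inj₁ (inj₂ p)
    join : ∀ {e} → Traversed es e ⊎ e ≡ (x , x) → Traversed ((x , x) ∷ es) e
    join (inj₁ (inj₁ p)) = inj₁ (there p)
    join (inj₁ (inj₂ p)) = inj₂ (there p)
    join (inj₂ refl)     = inj₁ (here refl)
    splitˡ : ∀ {z} → (z , z) ∈ (x , x) ∷ es → (z , z) ∈ es ⊎ z ≡ x
    splitˡ (here refl) = inj₂ refl
    splitˡ (there p)   = inj₁ p
    joinˡ : ∀ {z} → (z , z) ∈ es ⊎ z ≡ x → (z , z) ∈ (x , x) ∷ es
    joinˡ (inj₁ p)    = there p
    joinˡ (inj₂ refl) = here refl
  ...   | no x≢y = rest (visited? es y)
    where
    A′ : Card (Traversed ((x , y) ∷ es)) (suc (suc a))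
    A′ = card-suc {P = λ e → Traversed es e ⊎ e ≡ (x , y)} (y , x)
      [ (λ { (inj₁ p) → ¬t (inj₂ p) ; (inj₂ p) → ¬t (inj₁ p) }) , (λ { refl → x≢y refl }) ]′
      (λ e → mk⇔ split join) (card-suc (x , y) ¬t (λ e → mk⇔ id id) A)
      where
      split : ∀ {e} → Traversed ((x , y) ∷ es) e → (Traversed es e ⊎ e ≡ (x , y)) ⊎ e ≡ (y , x)
      split (inj₁ (here refl)) = inj₁ (inj₂ refl)
      split (inj₁ (there p))   = inj₁ (inj₁ (inj₁ p))
      split (inj₂ (here refl)) = inj₂ refl
      split (inj₂ (there p))   = inj₁ (inj₁ (inj₂ p))
      join : ∀ {e} → (Traversed es e ⊎ e ≡ (x , y)) ⊎ e ≡ (y , x) → Traversed ((x , y) ∷ es) e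
      join (inj₁ (inj₁ (inj₁ p))) = inj₁ (there p)
      join (inj₁ (inj₁ (inj₂ p))) = inj₂ (there p)
      join (inj₁ (inj₂ refl))     = inj₁ (here refl)
      join (inj₂ refl)            = inj₂ (here refl)
    L′ : Card (λ z → (z , z) ∈ (x , y) ∷ es) l
    L′ = card-resp (λ z → mk⇔ there λ { (here refl) → ⊥-elim (x≢y refl) ; (there p) → p }) L
    rest : Dec (Visited es y) → EulerCount ((x , y) ∷ es)
    rest (yes Vy) = v , suc (suc a) , l , suc c ,
      card-resp (old-⇔ Vy (λ z → mk⇔ id id)) V , A′ , L′ , bad a l v c eq ,
      mk⇔ (λ ()) λ (f , _) → ⊥-elim ([ x≢y , ¬t ]′ (f Vy))
    rest (no ¬Vy) = suc v , suc (suc a) , l , c ,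
      card-suc y ¬Vy (λ z → mk⇔ id id) V , A′ , L′ , good a l v c eq ,
      mk⇔ (λ c≡0 → (λ Vy → ⊥-elim (¬Vy Vy)) , to c⇔ c≡0) (from c⇔ ∘ proj₂)

  -- Cardinalities are unique, so the numbers may be computed without reference to the walk; the
  -- equation then amounts to `c ≡ 0`.
  acyclic-⇔ : ∀ {v a l} es → Connected es → Card (Visited es) v → Card (Traversed es) a →
    Card (λ x → (x , x) ∈ es) l → a + 2 ≡ l + 2 * v ⇔ Acyclic es
  acyclic-⇔ es conn V A L with v , a , l , c , V′ , A′ , L′ , eq , c⇔ ← euler es conn
    with refl ← card-unique V V′ | refl ← card-unique A A′ | refl ← card-unique L L′ =
    mk⇔ (λ eq′ → to c⇔ (*-cancelˡ-≡ c 0 2 (+-cancelˡ-≡ (l + 2 * v) (2 * c) 0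
                   (trans (sym eq) (trans eq′ (sym (+-identityʳ (l + 2 * v))))))))
        (λ ac → trans eq (trans (cong (λ c → l + 2 * v + 2 * c) (from c⇔ ac)) (+-identityʳ (l + 2 * v))))

-- The walk around a factor

module Walks {k : ℕ} (u : ℕ → Fin k) where

  open Factors u

  private
    shift : ∀ i j n → i + suc j + n ≡ i + j + suc n
    shift = solve-∀

  module Walk (N i : ℕ) where

    open Exploration _≟ʷ_ (class (suc N) i) public

    -- The offset makes `q` the position of the letter before the central factor, so that
    -- `factor q (suc (suc N))` is a two-sided extension of it.
    Central : ℕ → Set
    Central q = class N (suc q) ≡ class N (suc i)

    arc : ℕ → Word k × Word k
    arc q = class (suc N) q , class (suc N) (suc q)

    arcs : ℕ → List (Word k × Word k)
    arcs zero = []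
    arcs (suc n) with class N (suc (i + n)) ≟ʷ class N (suc i)
    ... | yes _ = arc (i + n) ∷ arcs n
    ... | no _  = arcs n

    ∈-arcs⁻ : ∀ n {e} → e ∈ arcs n → ∃[ q ] (i ≤ q × q < i + n × Central q × e ≡ arc q)
    ∈-arcs⁻ (suc n) e∈ with class N (suc (i + n)) ≟ʷ class N (suc i)
    ∈-arcs⁻ (suc n) (here refl) | yes c = i + n , m≤m+n i n , +-monoʳ-< i (n<1+n n) , c , refl
    ∈-arcs⁻ (suc n) (there e∈)  | yes _ =
      let (q , i≤q , q< , r) = ∈-arcs⁻ n e∈ in q , i≤q , <-trans q< (+-monoʳ-< i (n<1+n n)) , r
    ∈-arcs⁻ (suc n) e∈          | no _  =
      let (q , i≤q , q< , r) = ∈-arcs⁻ n e∈ in q , i≤q , <-trans q< (+-monoʳ-< i (n<1+n n)) , r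

    ∈-arcs⁺ : ∀ n {q} → i ≤ q → q < i + n → Central q → arc q ∈ arcs n
    ∈-arcs⁺ zero i≤q q< _ = contradiction (subst (_ <_) (+-identityʳ i) q<) (≤⇒≯ i≤q)
    ∈-arcs⁺ (suc n) {q} i≤q q< c
      with class N (suc (i + n)) ≟ʷ class N (suc i) | m≤n⇒m<n∨m≡n (≤-pred (subst (q <_) (+-suc i n) q<))
    ... | yes _ | inj₁ q<i+n = there (∈-arcs⁺ n i≤q q<i+n c)
    ... | yes _ | inj₂ refl  = here refl
    ... | no _  | inj₁ q<i+n = ∈-arcs⁺ n i≤q q<i+n c
    ... | no ¬c | inj₂ refl  = contradiction c ¬c

    start-visited : ∀ es → Visited es (class (suc N) i)
    start-visited []       = refl
    start-visited (_ ∷ es) = inj₁ (start-visited es)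

    visited⁻ : ∀ es {z} → Visited es z → z ≡ class (suc N) i ⊎ ∃[ x ] ((x , z) ∈ es)
    visited⁻ []             eq          = inj₁ eq
    visited⁻ ((x , _) ∷ es) (inj₂ refl) = inj₂ (x , here refl)
    visited⁻ (_ ∷ es)       (inj₁ V)    = [ inj₁ , (λ { (x , p) → inj₂ (x , there p) }) ]′ (visited⁻ es V)

    -- An arc ends at a central occurrence with the letter after it, and the next arc starts at the
    -- next central occurrence with the letter before it; `Mirroring N` identifies the two, so the
    -- arcs form an unbroken walk.
    connected : Mirroring N → ∀ n → Connected (arcs n)
    connected mirroring zero = tt
    connected mirroring (suc n) with class N (suc (i + n)) ≟ʷ class N (suc i)
    ... | no _  = connected mirroring n
    ... | yes c = source n (connected mirroring n) c , connected mirroring n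
      where
      source : ∀ n → Connected (arcs n) → Central (i + n) → Visited (arcs n) (class (suc N) (i + n))
      source zero    _ c = cong (class (suc N)) (+-identityʳ i)
      source (suc n) conn c
        with l , i≤l , l≤ , cl , none ← lastBefore (λ q → class N (suc q) ≟ʷ class N (suc i)) i (i + n) (m≤m+n i n) refl =
        subst (Visited (arcs (suc n))) step
          (proj₂ (endpoints-visited (arcs (suc n)) conn
            (∈-arcs⁺ (suc n) i≤l (subst (l <_) (sym (+-suc i n)) (s≤s l≤)) cl)))
        where
        none′ : ∀ x → suc l < x → x ≤ i + suc n → class N (suc l) ≢ class N x
        none′ (suc x) (s≤s l<x) x≤ eq =
          none x l<x (≤-pred (subst (suc x ≤_) (+-suc i n) x≤)) (trans (sym eq) cl)
        step : class (suc N) (suc l) ≡ class (suc N) (i + suc n)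
        step = Mirror⇒class (shift (suc l) (i + suc n) N)
          (mirroring (suc l) (i + suc n) (subst (suc l ≤_) (sym (+-suc i n)) (s≤s l≤)) (trans cl (sym c)) none′)

    -- Let `l ≤ q` be the last position of the vertex at which the arc of `q` ends. If `l ≡ q`, this
    -- arc is a loop; otherwise the reflection given by `Mirroring (suc N)` shows that the arc of
    -- `l` is the same edge in the opposite direction.
    acyclic : Mirroring (suc N) → ∀ n → Acyclic (arcs n)
    acyclic mirroring zero = tt
    acyclic mirroring (suc n) with class N (suc (i + n)) ≟ʷ class N (suc i)
    ... | no _  = acyclic mirroring n
    ... | yes c = revisit ∘ position ∘ visited⁻ (arcs n) , acyclic mirroring n
      where
      q = i + n
      position : class (suc N) (suc q) ≡ class (suc N) i ⊎ ∃[ x ] ((x , class (suc N) (suc q)) ∈ arcs n) →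
        ∃[ p ] (i ≤ p × p ≤ q × class (suc N) p ≡ class (suc N) (suc q))
      position (inj₁ eq)       = i , ≤-refl , m≤m+n i n , sym eq
      position (inj₂ (x , e∈)) = let (p , i≤p , p<q , _ , eq) = ∈-arcs⁻ n e∈ in
        suc p , m≤n⇒m≤1+n i≤p , p<q , sym (,-injectiveʳ eq)
      revisit : ∃[ p ] (i ≤ p × p ≤ q × class (suc N) p ≡ class (suc N) (suc q)) →
        class (suc N) q ≡ class (suc N) (suc q) ⊎ Traversed (arcs n) (arc q)
      revisit (p , i≤p , p≤q , eq)
        with l , p≤l , l≤q , eqˡ , none ← lastBefore (λ x → class (suc N) x ≟ʷ class (suc N) (suc q)) p q p≤q eq
        with mir ← mirroring l q l≤q eqˡ (λ x l<x x≤q e → none x l<x x≤q (trans (sym e) eqˡ))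
        with m≤n⇒m<n∨m≡n l≤q
      ... | inj₂ refl = inj₁ eqˡ
      ... | inj₁ l<q  = inj₂ (inj₂ (subst (_∈ arcs n)
        (cong₂ _,_ eqˡ (Mirror⇒class (arith l q N) (Mirror-mono (n≤1+n l) ≤-refl mir)))
        (∈-arcs⁺ n (≤-trans i≤p p≤l) l<q (trans
          (Mirror⇒class (arith′ l q N) (Mirror-mono (n≤1+n l) (n≤1+n q) mir)) c))))
        where
        arith : ∀ l q N → l + suc q + suc N ≡ suc l + q + suc N
        arith = solve-∀
        arith′ : ∀ l q N → l + suc q + suc N ≡ suc l + suc q + N
        arith′ = solve-∀

  -- The first hypothesis misses only the pair with `x ≡ i`; there `y ≡ suc (j + n)`, which lies
  -- beyond `j`, so the second hypothesis covers it.
  Mirror-extend : ∀ {i j n} → Mirror (suc i) j (i + suc j + suc n) → Mirror i (suc j) (i + suc j + suc n) →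
    Mirror i j (i + suc j + suc n)
  Mirror-extend {i} {j} {n} m₁ m₂ x y i≤x j≤y eq with m≤n⇒m<n∨m≡n i≤x
  ... | inj₁ i<x  = m₁ x y i<x j≤y eq
  ... | inj₂ refl = m₂ x y i≤x (subst (suc j ≤_) (sym y≡) (s≤s (m≤m+n j n))) eq
    where
    arith : ∀ i j n → i + suc j + suc n ≡ suc (i + suc (j + n))
    arith = solve-∀
    y≡ : y ≡ suc (j + n)
    y≡ = +-cancelˡ-≡ i y (suc (j + n)) (suc-injective (trans eq (arith i j n)))

  -- The only new pair is `x ≡ p + n`, `y ≡ j`. Repetition, reflection and repetition again lead
  -- from `u (p + n)` to `u (j + n)`, `u p` and `u j`; for `n ≡ 0` the first step suffices.
  repeat-Mirror : ∀ {p j} n → factor p (suc n) ≡ factor j (suc n) → Mirror p (suc j) (p + suc j + n) →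
    Mirror p j (p + suc j + n)
  repeat-Mirror {p} {j} n same mir x y p≤x j≤y eq with m≤n⇒m<n∨m≡n j≤y
  ... | inj₁ j<y  = mir x y p≤x j<y eq
  ... | inj₂ refl = trans (cong u x≡) (trans (letters n ≤-refl) (ends n refl))
    where
    letters : ∀ t → t ≤ n → u (p + t) ≡ u (j + t)
    letters t t≤n = factor-pointwise⁻ p j (suc n) same t (s≤s t≤n)
    arith : ∀ p j n → p + suc j + n ≡ suc (p + n + j)
    arith = solve-∀
    x≡ : x ≡ p + n
    x≡ = +-cancelʳ-≡ j x (p + n) (suc-injective (trans eq (arith p j n)))
    arith′ : ∀ p j n → suc (p + (j + n)) ≡ p + suc j + n
    arith′ = solve-∀
    ends : ∀ t → t ≡ n → u (j + t) ≡ u j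
    ends zero    refl = cong u (+-identityʳ j)
    ends (suc t) refl = begin
      u (j + suc t) ≡⟨ mir p (j + suc t) ≤-refl (m<m+n j (s≤s z≤n)) (arith′ p j (suc t)) ⟨
      u p           ≡⟨ cong u (+-identityʳ p) ⟨
      u (p + 0)     ≡⟨ letters 0 z≤n ⟩
      u (j + 0)     ≡⟨ cong u (+-identityʳ j) ⟩
      u j           ∎
      where open ≡-Reasoning

  -- If the two occurrences are mirror images, the walk from `i` is back at its start after the arc
  -- of `j`, and acyclicity leaves few possibilities for that arc. A repetition turns out to be a
  -- mirror image as well.
  mirroring-suc : ∀ N → Mirroring N → (∀ i n → Walk.Acyclic N i (Walk.arcs N i n)) → Mirroring (suc N)
  mirroring-suc N mirroring acyclic′ i j i≤j same none = [ repeated , reversed ]′ (class-≡ same)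
    where
    open Walk N i
    s = i + suc j + suc N
    shift′ : ∀ i j N → i + suc j + suc N ≡ suc i + suc j + N
    shift′ = solve-∀
    arith : ∀ i j N → i + suc j + suc N ≡ suc i + j + suc N
    arith = solve-∀
    reversed : Mirror i (suc j) s → Mirror i j s
    reversed mir with d , refl ← m≤n⇒∃[o]m+o≡n i≤j = close (acyclic′ i (suc d))
      where
      central : Central (i + d)
      central = sym (Mirror⇒class (shift′ i (i + d) N) (Mirror-mono (n≤1+n i) ≤-refl mir))
      extend : class (suc N) (i + d) ≡ class (suc N) (suc (i + d)) ⊎ Traversed (arcs d) (arc (i + d)) → Mirror i (i + d) s
      -- A loop puts an occurrence at `j`, so `i ≡ j`, and `mir` together with its symmetric form
      -- suffices.
      extend (inj₁ loop) with m≤n⇒m<n∨m≡n i≤j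
      ... | inj₁ i<j = ⊥-elim (none (i + d) i<j ≤-refl (trans same (sym loop)))
      ... | inj₂ i≡j = Mirror-extend (subst₂ (λ a b → Mirror (suc a) b s) (sym i≡j) i≡j (Mirror-sym mir)) mir
      -- An earlier arc in the same direction would have returned to the start too soon, at
      -- `suc q ≤ j`.
      extend (inj₂ (inj₁ e∈)) = let (q , i≤q , q<j , _ , eq) = ∈-arcs⁻ d e∈ in
        ⊥-elim (none (suc q) (s≤s i≤q) q<j (trans same (,-injectiveʳ eq)))
      -- The opposite arc leaves from the starting vertex, so it is the arc of `i`, and its end
      -- relates the factors at `suc i` and `j`. This yields the inner part of the reflection, even
      -- when these factors are equal instead of mirrored.
      extend (inj₂ (inj₂ e∈)) with q , i≤q , q<j , _ , eq ← ∈-arcs⁻ d e∈ with m≤n⇒m<n∨m≡n i≤q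
      ... | inj₁ i<q  = ⊥-elim (none q i<q (<⇒≤ q<j) (trans same (,-injectiveˡ eq)))
      ... | inj₂ refl = Mirror-extend (inner (class-≡ (sym (,-injectiveʳ eq)))) mir
        where
        inner : factor (suc i) (suc N) ≡ factor (i + d) (suc N) ⊎ Mirror (suc i) (i + d) (suc i + (i + d) + suc N) →
          Mirror (suc i) (i + d) s
        inner (inj₁ eq′)  = subst (Mirror (suc i) (i + d)) (sym (shift′ i (i + d) N)) (repeat-Mirror N eq′
          (subst (Mirror (suc i) (suc (i + d))) (shift′ i (i + d) N) (Mirror-mono (n≤1+n i) ≤-refl mir)))
        inner (inj₂ mir′) = subst (Mirror (suc i) (i + d)) (sym (arith i (i + d) N)) mir′
      close : Acyclic (arcs (suc d)) → Mirror i (i + d) s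
      close ac with class N (suc (i + d)) ≟ʷ class N (suc i)
      ... | yes _ = extend (proj₁ ac (subst (Visited (arcs d)) same (start-visited (arcs d))))
      ... | no ¬c = contradiction central ¬c
    repeated : factor i (suc N) ≡ factor (suc j) (suc N) → Mirror i j s
    repeated eq
      -- For the last central occurrence `l` before `suc (suc j)`, `Mirroring N` equates the classes
      -- of length `suc N` at `l` and `suc j`. Hence `l ≡ suc j`, and the repeated factor is a
      -- palindrome.
      with l , i<l , l≤j+1 , eqˡ , noneˡ ← lastBefore (λ x → class N x ≟ʷ class N (suc (suc j))) (suc i) (suc j)
        (s≤s i≤j) (cong canonical (∷-injectiveʳ eq))
      with mir ← mirroring l (suc j) l≤j+1 eqˡ (λ x l<x x≤ e → noneˡ x l<x x≤ (trans (sym e) eqˡ))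
      with m≤n⇒m<n∨m≡n l≤j+1
    ... | inj₁ (s≤s l≤j) = ⊥-elim (none l i<l l≤j (trans same (sym (Mirror⇒class (shift l (suc j) N) mir))))
    ... | inj₂ refl = reversed (factor≡reverse⇒Mirror (suc N) refl
      (trans eq (Mirror⇒factor≡reverse (suc N) (shift (suc j) (suc j) N) mir)))

-- Extension sets and the local graph

take-length-++ : ∀ {A : Set} (w v : List A) → take (length w) (w ++ v) ≡ w
take-length-++ []      v = refl
take-length-++ (a ∷ w) v = cong (a ∷_) (take-length-++ w v)

card-inhabited : ∀ {X : Set} {P : Pred X 0ℓ} {n x} → P x → Card P n → 1 ≤ n
card-inhabited Px (xs , _ , xs⇔ , refl) with xs | from (xs⇔ _) Px
... | _ ∷ _ | _ = s≤s z≤n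

card-one : ∀ {X : Set} {P : Pred X 0ℓ} {x y} → Card P 1 → P x → P y → x ≡ y
card-one (z ∷ [] , _ , xs⇔ , refl) Px Py with from (xs⇔ _) Px | from (xs⇔ _) Py
... | here refl | here refl = refl

module Languages {k : ℕ} (u : InfiniteWord k) (closed : ClosedUnderReversal u) where

  open Factors (letter u)
  open Walks (letter u)

  factor-language : ∀ i n → Language u (factor i n)
  factor-language i n = i , n , sym (applyUpTo-factor _ i n λ _ → refl)

  language⇒factor : ∀ {w} → Language u w → ∃[ i ] (factor i (length w) ≡ w)
  language⇒factor (i , n , refl) = i , trans (cong (factor i) (length-applyUpTo _ n))
    (sym (applyUpTo-factor _ i n λ _ → refl))

  -- The reversal of a long prefix contains the reversal of a given factor near its end.
  recurrent : ∀ {w} → Language u w → ∀ m → ∃[ i ] (m ≤ i × factor i (length w) ≡ w)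
  recurrent {w} w∈ m
    with i , eq ← language⇒factor (closed w w∈)
    with j , eq′ ← language⇒factor (closed _ (factor-language 0 (i + length w + m)))
    with mir ← factor≡reverse⇒Mirror (i + length w + m) refl (trans (cong (factor j) (sym
                 (trans (length-reverse (factor 0 (i + length w + m))) (length-factor 0 (i + length w + m))))) eq′) =
    m + j , m≤m+n m j , (begin
      factor (m + j) L      ≡⟨ Mirror⇒factor≡reverse L (arith j i L m) (Mirror-mono (m≤n+m j m) z≤n mir) ⟩
      reverse (factor i L)  ≡⟨ cong (reverse ∘ factor i) (length-reverse w) ⟨
      reverse (factor i (length (reverse w))) ≡⟨ cong reverse eq ⟩
      reverse (reverse w)   ≡⟨ reverse-involutive w ⟩
      w                     ∎)
    where
    open ≡-Reasoning
    L = length w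
    arith : ∀ j i L m → j + 0 + (i + L + m) ≡ m + j + i + L
    arith = solve-∀

  tail-language : ∀ {a w} → Language u (a ∷ w) → Language u w
  tail-language {a} {w} aw∈ = let (i , eq) = language⇒factor aw∈ in
    subst (Language u) (∷-injectiveʳ eq) (factor-language (suc i) (length w))

  closed⁻ : ∀ {w} → Language u (reverse w) → Language u w
  closed⁻ {w} w∈ = subst (Language u) (reverse-involutive w) (closed _ w∈)

  init-language : ∀ {a w} → Language u (w ∷ʳ a) → Language u w
  init-language {a} {w} wa∈ =
    closed⁻ (tail-language (subst (Language u) (reverse-∷ʳ w a) (closed _ wa∈)))

  extendʳ : ∀ {w} → Language u w → ∃[ b ] Language u (w ∷ʳ b)
  extendʳ {w} w∈ = let (i , eq) = language⇒factor w∈ in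
    letter u (i + length w) , subst (Language u)
      (trans (factor-∷ʳ i (length w)) (cong (_∷ʳ letter u (i + length w)) eq)) (factor-language i (suc (length w)))

  -- An occurrence at position 0 has no letter before it; hence the detour through the reversal.
  extendˡ : ∀ {w} → Language u w → ∃[ a ] Language u (a ∷ w)
  extendˡ {w} w∈ = let (b , wb∈) = extendʳ (closed w w∈) in
    b , closed⁻ (subst (Language u) (sym (unfold-reverse b w)) wb∈)

  palindrome-Rext⇔Lext : ∀ {w} → Palindrome w → ∀ a → Rext u w a ⇔ Lext u w a
  palindrome-Rext⇔Lext {w} pal a = mk⇔
    (λ wa∈ → subst (Language u) rev (closed _ wa∈)) (λ aw∈ → closed⁻ (subst (Language u) (sym rev) aw∈))
    where
    rev : reverse (w ∷ʳ a) ≡ a ∷ w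
    rev = trans (reverse-∷ʳ w a) (cong (a ∷_) (sym pal))

  module Local (w : Word k) where

    private N = length w

    -- In the local graph of w, every a ∷ (w ∷ʳ b) joins {a ∷ w , its reversal} to {w ∷ʳ b , its reversal}.
    ends : Word k → Word k × Word k
    ends e = canonical (take (suc N) e) , canonical (drop 1 e)

    ends-≡ : ∀ a b → ends (a ∷ (w ∷ʳ b)) ≡ (canonical (a ∷ w) , canonical (w ∷ʳ b))
    ends-≡ a b = cong (λ v → canonical (a ∷ v) , canonical (w ∷ʳ b)) (take-length-++ w (b ∷ []))

    ends-injective : ∀ e e′ → Bext u w e → Bext u w e′ → ends e ≡ ends e′ → e ≡ e′
    ends-injective _ _ (a , b , refl , _) (c , d , refl , _) eq
      with eq′ ← trans (sym (ends-≡ a b)) (trans eq (ends-≡ c d)) =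
      cong₂ (λ x y → x ∷ (w ∷ʳ y)) (canonical-∷-injective w (,-injectiveˡ eq′))
                                  (canonical-∷ʳ-injective w (,-injectiveʳ eq′))

    Link : Pred (Word k × Word k) 0ℓ
    Link e = Image ends (Bext u w) e ⊎ Image (swap ∘ ends) (Bext u w) e

    Node : Pred (Word k) 0ℓ
    Node x = Image (λ a → canonical (a ∷ w)) (Lext u w) x ⊎ Image (λ b → canonical (w ∷ʳ b)) (Rext u w) x

    link-nodes : ∀ {x y} → Link (x , y) → Node x × Node y
    link-nodes (inj₁ (_ , (a , b , refl , e∈) , eq)) with refl ← trans eq (ends-≡ a b) =
      inj₁ (a , init-language {b} e∈ , refl) , inj₂ (b , tail-language e∈ , refl)
    link-nodes (inj₂ (_ , (a , b , refl , e∈) , eq)) with refl ← trans eq (cong swap (ends-≡ a b)) =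
      inj₂ (b , tail-language e∈ , refl) , inj₁ (a , init-language {b} e∈ , refl)

    -- As no node is isolated, a walk along all links visits all nodes.
    node-link : ∀ {x} → Node x → ∃[ y ] Link (x , y)
    node-link (inj₁ (a , aw∈ , refl)) = let (b , e∈) = extendʳ aw∈ in
      _ , inj₁ (_ , (a , b , refl , e∈) , sym (ends-≡ a b))
    node-link (inj₂ (b , wb∈ , refl)) = let (a , e∈) = extendˡ wb∈ in
      _ , inj₂ (_ , (a , b , refl , e∈) , cong swap (sym (ends-≡ a b)))

    module _ (i : ℕ) (at-i : class N (suc i) ≡ canonical w) where

      open Walk N i

      -- An occurrence of `w` gives its extension in the direct orientation; one of `reverse w`
      -- gives the reversed extension, with the ends swapped.
      arc-link : ∀ q → Central q → Link (arc q)
      arc-link q c with canonical-≡ (trans c at-i)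
      ... | inj₁ eq = inj₁ (_ , (a , b , refl , subst (λ v → Language u (a ∷ v)) eq′ (factor-language q (suc (suc N)))) ,
              trans (cong₂ (λ v v′ → canonical (a ∷ v) , canonical v′) eq eq′) (sym (ends-≡ a b)))
        where
        a = letter u q
        b = letter u (suc q + N)
        eq′ : factor (suc q) (suc N) ≡ w ∷ʳ b
        eq′ = trans (factor-∷ʳ (suc q) N) (cong (_∷ʳ b) eq)
      ... | inj₂ eq = inj₂ (_ , (b , a , refl , subst (Language u) rev (closed _ (factor-language q (suc (suc N))))) ,
              trans (cong₂ _,_ (trans (cong (λ v → canonical (a ∷ v)) eq) (sym (canonical-∷ʳ w a)))
                               (trans (cong canonical eq′) (trans (canonical-∷ʳ (reverse w) b)
                                 (cong (λ v → canonical (b ∷ v)) (reverse-involutive w)))))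
                    (cong swap (sym (ends-≡ b a))))
        where
        a = letter u q
        b = letter u (suc q + N)
        eq′ : factor (suc q) (suc N) ≡ reverse w ∷ʳ b
        eq′ = trans (factor-∷ʳ (suc q) N) (cong (_∷ʳ b) eq)
        rev : reverse (factor q (suc (suc N))) ≡ b ∷ (w ∷ʳ a)
        rev = trans (cong (λ v → reverse (a ∷ v)) eq′) (trans (reverse-∷-∷ʳ a (reverse w) b)
                (cong (λ v → b ∷ (v ∷ʳ a)) (reverse-involutive w)))

      Covers : ℕ → Set
      Covers n = ∀ {e} → Bext u w e → ∃[ q ] (i ≤ q × q < i + n × factor q (length e) ≡ e)

      covers-mono : ∀ {m n} → m ≤ n → Covers m → Covers n
      covers-mono m≤n cov e∈ = let (q , i≤q , q< , eq) = cov e∈ in q , i≤q , <-≤-trans q< (+-monoʳ-≤ i m≤n) , eq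

      -- `Card` supplies a finite list, and by recurrence each of its members occurs from `i` on.
      -- Adding up the bounds replaces taking their maximum.
      cover : ∀ {b} → Card (Bext u w) b → ∃[ n ] Covers n
      cover (xs , _ , xs⇔ , _) = let (n , cov) = window xs (λ {e} e∈ → let (_ , _ , _ , p) = to (xs⇔ e) e∈ in p) in
        n , λ {e} e∈ → cov (from (xs⇔ e) e∈)
        where
        window : ∀ xs → (∀ {e} → e ∈ xs → Language u e) →
          ∃[ n ] (∀ {e} → e ∈ xs → ∃[ q ] (i ≤ q × q < i + n × factor q (length e) ≡ e))
        window []       _  = 0 , λ ()
        window (x ∷ xs) ∈L
          with n , cov ← window xs (∈L ∘ there) | q , i≤q , eq ← recurrent (∈L (here refl)) i =
          suc q + n , λ where
            (here refl) → q , i≤q , ≤-trans (m≤m+n (suc q) n) (m≤n+m (suc q + n) i) , eq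
            (there e∈)  → let (q′ , i≤q′ , q′< , eq′) = cov e∈ in
              q′ , i≤q′ , <-≤-trans q′< (+-monoʳ-≤ i (m≤n+m n (suc q))) , eq′

      traversed⇔link : ∀ n → Covers n → ∀ e → Link e ⇔ Traversed (arcs n) e
      traversed⇔link n cov e = mk⇔ [ (λ { (e′ , e∈ , refl) → inj₁ (arc∈ e∈) }) , (λ { (e′ , e∈ , refl) → inj₂ (arc∈ e∈) }) ]′
        [ link , swap-link ∘ link ]′
        where
        link : ∀ {e} → e ∈ arcs n → Link e
        link e∈ with q , _ , _ , c , refl ← ∈-arcs⁻ n e∈ = arc-link q c
        swap-link : ∀ {x y} → Link (x , y) → Link (y , x)
        swap-link = [ (λ { (e , e∈ , eq) → inj₂ (e , e∈ , cong swap eq) }) ,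
                      (λ { (e , e∈ , eq) → inj₁ (e , e∈ , cong swap eq) }) ]′
        arc∈ : ∀ {e} → Bext u w e → ends e ∈ arcs n
        arc∈ e∈@(a , b , refl , _) with q , i≤q , q< , eq ← cov e∈ =
          subst (_∈ arcs n) (trans (cong₂ (λ x y → canonical x , canonical y)
              (cong₂ _∷_ (∷-injectiveˡ eq) center) right) (sym (ends-≡ a b)))
            (∈-arcs⁺ n i≤q q< (trans (cong canonical center) (sym at-i)))
          where
          right : factor (suc q) (suc N) ≡ w ∷ʳ b
          right = trans (cong (factor (suc q)) (sym (trans (length-++ w) (+-comm N 1)))) (∷-injectiveʳ eq)
          center : factor (suc q) N ≡ w
          center = ∷ʳ-injectiveˡ (factor (suc q) N) w (trans (sym (factor-∷ʳ (suc q) N)) right)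

      visited⇔node : ∀ n → Covers n → Connected (arcs n) → ∀ x → Node x ⇔ Visited (arcs n) x
      visited⇔node n cov conn x = mk⇔
        (λ nd → proj₁ (traversed-visited (arcs n) conn (to (traversed⇔link n cov _) (proj₂ (node-link nd)))))
        (node ∘ visited⁻ (arcs n))
        where
        node : x ≡ class (suc N) i ⊎ ∃[ y ] ((y , x) ∈ arcs n) → Node x
        node (inj₁ refl)     = proj₁ (link-nodes (arc-link i refl))
        node (inj₂ (y , e∈)) = proj₂ (link-nodes (from (traversed⇔link n cov (y , x)) (inj₁ e∈)))

      loops⇔link : ∀ n → Covers n → ∀ x → Link (x , x) ⇔ (x , x) ∈ arcs n
      loops⇔link n cov x = mk⇔ ([ id , id ]′ ∘ to (traversed⇔link n cov (x , x)))
                               (from (traversed⇔link n cov (x , x)) ∘ inj₁)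

      acyclic-arcs⁻ : ∀ m n → Acyclic (arcs (m + n)) → Acyclic (arcs n)
      acyclic-arcs⁻ zero    n ac = ac
      acyclic-arcs⁻ (suc m) n ac with class N (suc (i + (m + n))) ≟ʷ class N (suc i)
      ... | yes _ = acyclic-arcs⁻ m n (proj₂ ac)
      ... | no _  = acyclic-arcs⁻ m n ac

      -- Every walk through a covering window has exactly the given counts, however long it is, and
      -- shorter walks inherit acyclicity; so a single equation settles all `n`.
      acyclic⇔count : ∀ {b v a l} → Mirroring N → Card (Bext u w) b →
        Card Node v → Card Link a → Card (λ x → Link (x , x)) l →
        a + 2 ≡ l + 2 * v ⇔ (∀ n → Acyclic (arcs n))
      acyclic⇔count {v = v} {a} {l} mirroring B V A L with m , cov ← cover B =
        mk⇔ (λ eq n → acyclic-arcs⁻ m n (to (count (m + n) (covers-mono (m≤m+n m n) cov)) eq))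
            (λ ac → from (count m cov) (ac m))
        where
        count : ∀ n → Covers n → a + 2 ≡ l + 2 * v ⇔ Acyclic (arcs n)
        count n cov = let conn = connected mirroring n in
          acyclic-⇔ (arcs n) conn (card-resp (visited⇔node n cov conn) V)
            (card-resp (traversed⇔link n cov) A) (card-resp (loops⇔link n cov) L)

      -- The graph has `l + r` nodes, no loops, and `b` edges with two orientations each. The halved
      -- Euler equation is stated with an extra 1 on both sides, to match the palindromic case with
      -- 1 for `p`.
      acyclic-nonpalindrome : ∀ {b r l} → ¬ Palindrome w → Mirroring N →
        Card (Bext u w) b → Card (Rext u w) r → Card (Lext u w) l →
        b + 2 ≡ 1 + (r + l) ⇔ (∀ n → Acyclic (arcs n))
      acyclic-nonpalindrome {b} {r} {l} ¬pal mirroring B R L = mk⇔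
        (to iff ∘ fwd) (bwd ∘ from iff)
        where
        iff : (b + b) + 2 ≡ 0 + 2 * (l + r) ⇔ (∀ n → Acyclic (arcs n))
        iff = acyclic⇔count mirroring B
          (card-⊎ (λ { _ (a , _ , refl) (b , _ , eq) → ¬pal (canonical-∷≡∷ʳ⇒palindrome w eq) })
            (card-image _ (λ _ _ _ _ → canonical-∷-injective w) L)
            (card-image _ (λ _ _ _ _ → canonical-∷ʳ-injective w) R))
          (card-⊎ (λ { _ (_ , (a , b , refl , _) , refl) (_ , (c , d , refl , _) , eq) →
                       ¬pal (canonical-∷≡∷ʳ⇒palindrome w (,-injectiveˡ
                         (trans (sym (ends-≡ a b)) (trans eq (cong swap (ends-≡ c d)))))) })
            (card-image ends ends-injective B)
            (card-image (swap ∘ ends) (λ e e′ p p′ eq → ends-injective e e′ p p′ (cong swap eq)) B))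
          (card-empty λ { x (inj₁ (_ , (a , b , refl , _) , eq)) → no-loop a b eq
                        ; x (inj₂ (_ , (a , b , refl , _) , eq)) → no-loop a b (cong swap eq) })
          where
          no-loop : ∀ {x} a b → ¬ (x , x) ≡ ends (a ∷ (w ∷ʳ b))
          no-loop a b eq with eq′ ← trans eq (ends-≡ a b) =
            ¬pal (canonical-∷≡∷ʳ⇒palindrome w (trans (sym (,-injectiveˡ eq′)) (,-injectiveʳ eq′)))
        double : ∀ b → b + b + 2 ≡ 2 * (b + 1)
        double = solve-∀
        shift : ∀ b → b + 2 ≡ 1 + (b + 1)
        shift = solve-∀
        fwd : b + 2 ≡ 1 + (r + l) → b + b + 2 ≡ 2 * (l + r)
        fwd eq = trans (double b) (cong (2 *_) (trans (suc-injective (trans (sym (shift b)) eq)) (+-comm r l)))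
        bwd : b + b + 2 ≡ 2 * (l + r) → b + 2 ≡ 1 + (r + l)
        bwd eq = trans (shift b) (cong suc (trans (*-cancelˡ-≡ (b + 1) (l + r) 2 (trans (sym (double b)) eq)) (+-comm l r)))

      -- Reversal identifies right with left extensions, which leaves `l` nodes, and it turns
      -- `a ∷ (w ∷ʳ b)` into the opposite orientation of the same edge, so `b` already counts both.
      -- The loops are the palindromic extensions.
      acyclic-palindrome : ∀ {b r l p} → Palindrome w → Mirroring N →
        Card (Bext u w) b → Card (Rext u w) r → Card (Lext u w) l → Card (Pext u w) p →
        b + 2 ≡ p + (r + l) ⇔ (∀ n → Acyclic (arcs n))
      acyclic-palindrome {b} {r} {l} {p} pal mirroring B R L P
        with refl ← card-unique (card-resp (palindrome-Rext⇔Lext pal) R) L =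
        -- `2 * l` computes to `l + (l + 0)`.
        subst (λ s → b + 2 ≡ p + (l + s) ⇔ (∀ n → Acyclic (arcs n))) (+-identityʳ l)
          (acyclic⇔count mirroring B
            (card-resp (λ x → mk⇔ inj₁ [ id , flip-node ]′) (card-image _ (λ _ _ _ _ → canonical-∷-injective w) L))
            (card-resp (λ x → mk⇔ inj₁ [ id , flip-link ]′) (card-image ends ends-injective B))
            (card-resp loops (card-image (proj₁ ∘ ends)
              (λ { _ _ (a , refl , _) (c , refl , _) eq → cong (λ x → x ∷ (w ∷ʳ x))
                (canonical-∷-injective w (trans (sym (,-injectiveˡ (ends-≡ a a))) (trans eq (,-injectiveˡ (ends-≡ c c))))) }) P)))
        where
        flip : ∀ a → canonical (w ∷ʳ a) ≡ canonical (a ∷ w)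
        flip a = trans (canonical-∷ʳ w a) (cong (λ v → canonical (a ∷ v)) (sym pal))
        flip-node : ∀ {x} → Image (λ b → canonical (w ∷ʳ b)) (Rext u w) x → Image (λ a → canonical (a ∷ w)) (Lext u w) x
        flip-node (b , wb∈ , refl) = b , to (palindrome-Rext⇔Lext pal b) wb∈ , flip b
        flip-link : ∀ {e} → Image (swap ∘ ends) (Bext u w) e → Image ends (Bext u w) e
        flip-link (_ , (a , b , refl , e∈) , refl) =
          _ , (b , a , refl , subst (Language u) rev (closed _ e∈)) ,
          trans (cong swap (ends-≡ a b)) (trans (cong₂ _,_ (flip b) (sym (flip a))) (sym (ends-≡ b a)))
          where
          rev : reverse (a ∷ (w ∷ʳ b)) ≡ b ∷ (w ∷ʳ a)
          rev = trans (reverse-∷-∷ʳ a w b) (cong (λ v → b ∷ (v ∷ʳ a)) (sym pal))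
        loops : ∀ x → Image (proj₁ ∘ ends) (Pext u w) x ⇔ Link (x , x)
        loops x = mk⇔
          (λ { (_ , (a , refl , e∈) , refl) → inj₁ (_ , (a , a , refl , e∈) ,
               cong₂ _,_ refl (trans (,-injectiveˡ (ends-≡ a a)) (sym (flip a)))) })
          (back ∘ [ id , flip-link ]′)
          where
          back : Image ends (Bext u w) (x , x) → Image (proj₁ ∘ ends) (Pext u w) x
          back (_ , (a , b , refl , e∈) , eq)
            with eq′ ← trans eq (ends-≡ a b)
            with refl ← canonical-∷-injective w (trans (sym (,-injectiveˡ eq′)) (trans (,-injectiveʳ eq′) (flip b))) =
            _ , (a , refl , e∈) , ,-injectiveˡ eq

-- The bilateral order

-- Clears the subtractions, to reach the form of the Euler count. With `p ≡ 1` the prescribed order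
-- is `0ℤ`, as for non-palindromes.
order⇔count : ∀ b r l p → + b - + r - + l ℤ.+ + 1 ≡ + p - 1ℤ ⇔ b + 2 ≡ p + (r + l)
order⇔count b r l p = mk⇔
  (λ eq → ℤ.+-injective (trans (left (+ b) (+ r) (+ l))
    (trans (cong (ℤ._+ (+ r ℤ.+ + l ℤ.+ 1ℤ)) eq) (right (+ p) (+ r) (+ l)))))
  (λ eq → trans (left′ (+ b) (+ r) (+ l))
    (trans (cong (λ x → x - (+ r ℤ.+ + l) - 1ℤ) (cong +_ eq)) (right′ (+ p) (+ r) (+ l))))
  where
  left : ∀ b r l → b ℤ.+ + 2 ≡ (b - r - l ℤ.+ + 1) ℤ.+ (r ℤ.+ l ℤ.+ 1ℤ)
  left = ℤ.solve-∀
  right : ∀ p r l → (p - 1ℤ) ℤ.+ (r ℤ.+ l ℤ.+ 1ℤ) ≡ p ℤ.+ (r ℤ.+ l)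
  right = ℤ.solve-∀
  left′ : ∀ b r l → b - r - l ℤ.+ + 1 ≡ (b ℤ.+ + 2) - (r ℤ.+ l) - 1ℤ
  left′ = ℤ.solve-∀
  right′ : ∀ p r l → (p ℤ.+ (r ℤ.+ l)) - (r ℤ.+ l) - 1ℤ ≡ p - 1ℤ
  right′ = ℤ.solve-∀

1≤∧≱2⇒≡1 : ∀ {m} → 1 ≤ m → ¬ 2 ≤ m → m ≡ 1
1≤∧≱2⇒≡1 (s≤s {n = zero} _)  _  = refl
1≤∧≱2⇒≡1 (s≤s {n = suc _} _) ≱2 = contradiction (s≤s (s≤s z≤n)) ≱2

-- Richness, mirroring and the order condition

module Characterisation {k : ℕ} (u : InfiniteWord k) (closed : ClosedUnderReversal u) where

  open Factors (letter u)
  open Walks (letter u)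
  open Palindromes (letter u)
  open Languages u closed

  rich⇔mirroring : Rich u ⇔ (∀ N → Mirroring N)
  rich⇔mirroring = mk⇔ (λ rich → rich⇒mirroring λ i n →
      subst (λ m → Card (λ v → Within i n v × Palindrome v) (m + 1)) (length-factor i n)
        (card-resp (λ v → mk⇔ (λ (p , q) → infix⁻ i n p , q) (λ (p , q) → infix⁺ i n p , q))
          (rich (factor i n) (factor-language i n))))
    (λ mirroring w w∈ → let (i , eq) = language⇒factor w∈ in
      subst (λ v → Card (λ x → Infix _≡_ x v × Palindrome x) (length w + 1)) eq
        (card-resp (λ v → mk⇔ (λ (p , q) → infix⁺ i (length w) p , q) (λ (p , q) → infix⁻ i (length w) p , q))
          (mirroring⇒rich mirroring i (length w))))

  -- The empty word occurs everywhere, so consecutive occurrences are adjacent: `i ≡ j`, and the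
  -- only reflected pair is `x ≡ y ≡ i`.
  mirroring-zero : Mirroring 0
  mirroring-zero i j i≤j _ none x y i≤x j≤y eq with m≤n⇒m<n∨m≡n i≤j
  ... | inj₁ i<j  = ⊥-elim (none j i<j ≤-refl refl)
  ... | inj₂ refl with m≤n⇒m<n∨m≡n i≤x | m≤n⇒m<n∨m≡n j≤y
  ...   | inj₂ refl | inj₂ refl = refl
  ...   | inj₁ i<x  | _         = contradiction eq (>⇒≢ (subst (_< suc (x + y)) arith (s≤s (+-mono-≤ i<x j≤y))))
    where
    arith : suc i + i ≡ i + suc i + 0
    arith = trans (sym (+-suc i i)) (sym (+-identityʳ (i + suc i)))
  ...   | inj₂ refl | inj₁ i<y  = contradiction eq (>⇒≢ (subst (_< suc (i + y)) (sym (+-identityʳ (i + suc i))) (s≤s (+-monoʳ-≤ i i<y))))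

  OrderCondition : Word k → Set
  OrderCondition w =
    (¬ Palindrome w → ∀ z → BilateralOrder u w z → z ≡ 0ℤ) ×
    (Palindrome w → ∀ z p → BilateralOrder u w z → Card (Pext u w) p → z ≡ + p - 1ℤ)

  mirroring⇒order : (∀ N → Mirroring N) → ∀ w → Language u w → OrderCondition w
  -- The bound 1 leaves room for a letter before the occurrence, where the walk starts.
  mirroring⇒order mirroring w w∈ with recurrent w∈ 1
  ... | suc i , _ , eq =
    (λ { ¬pal _ (b , r , l , B , R , L , refl) → from (order⇔count b r l 1)
           (from (acyclic-nonpalindrome i (cong canonical eq) ¬pal (mirroring N) B R L) (acyclic i)) }) ,
    (λ { pal _ p (b , r , l , B , R , L , refl) P → from (order⇔count b r l p)
           (from (acyclic-palindrome i (cong canonical eq) pal (mirroring N) B R L P) (acyclic i)) })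
    where
    open Local w
    N = length w
    acyclic : ∀ i n → Walk.Acyclic N i (Walk.arcs N i n)
    acyclic i = Walk.acyclic N i (mirroring (suc N))

  -- The local graph of a factor that is not bispecial is a star, so the count holds for it anyway.
  Bext-card-lext-one : ∀ {w r} → Language u w → Card (Lext u w) 1 → Card (Rext u w) r → Card (Bext u w) r
  Bext-card-lext-one {w} w∈ L R with a , aw∈ ← extendˡ w∈ =
    card-resp (λ v → mk⇔ fwd bwd)
      (card-image (λ b → a ∷ (w ∷ʳ b)) (λ _ _ _ _ eq → ∷ʳ-injectiveʳ w w (∷-injectiveʳ eq)) R)
    where
    fwd : ∀ {v} → Image (λ b → a ∷ (w ∷ʳ b)) (Rext u w) v → Bext u w v
    fwd (b , wb∈ , refl) with c , e∈ ← extendˡ wb∈ with refl ← card-one L aw∈ (init-language {b} e∈) =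
      a , b , refl , e∈
    bwd : ∀ {v} → Bext u w v → Image (λ b → a ∷ (w ∷ʳ b)) (Rext u w) v
    bwd (c , b , refl , e∈) with refl ← card-one L aw∈ (init-language {b} e∈) = b , tail-language e∈ , refl

  Bext-card-rext-one : ∀ {w l} → Language u w → Card (Rext u w) 1 → Card (Lext u w) l → Card (Bext u w) l
  Bext-card-rext-one {w} w∈ R L with b , wb∈ ← extendʳ w∈ =
    card-resp (λ v → mk⇔ fwd bwd)
      (card-image (λ a → a ∷ (w ∷ʳ b)) (λ _ _ _ _ eq → ∷-injectiveˡ eq) L)
    where
    fwd : ∀ {v} → Image (λ a → a ∷ (w ∷ʳ b)) (Lext u w) v → Bext u w v
    fwd (a , aw∈ , refl) with c , e∈ ← extendʳ aw∈ with refl ← card-one R wb∈ (tail-language e∈) =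
      a , b , refl , e∈
    bwd : ∀ {v} → Bext u w v → Image (λ a → a ∷ (w ∷ʳ b)) (Lext u w) v
    bwd (a , c , refl , e∈) with refl ← card-one R wb∈ (tail-language e∈) = a , init-language {b} e∈ , refl

  count-nonpalindrome : ∀ {w b r l} → (Bispecial u w → OrderCondition w) → Language u w → ¬ Palindrome w →
    Card (Bext u w) b → Card (Rext u w) r → Card (Lext u w) l → b + 2 ≡ 1 + (r + l)
  count-nonpalindrome {w} {b} {r} {l} cond w∈ ¬pal B R L with 2 ≤? l | 2 ≤? r
  ... | yes 2≤l | yes 2≤r = to (order⇔count b r l 1)
    (proj₁ (cond (w∈ , (l , L , 2≤l) , (r , R , 2≤r))) ¬pal _ (b , r , l , B , R , L , refl))
  ... | no 2≰l | _
    with refl ← 1≤∧≱2⇒≡1 (card-inhabited (proj₂ (extendˡ w∈)) L) 2≰l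
    with refl ← card-unique B (Bext-card-lext-one w∈ L R) = +-suc b 1
  ... | yes _ | no 2≰r
    with refl ← 1≤∧≱2⇒≡1 (card-inhabited (proj₂ (extendʳ w∈)) R) 2≰r
    with refl ← card-unique B (Bext-card-rext-one w∈ R L) = +-comm b 2

  -- By reversal, the right extensions of a palindrome are its left ones, so both letters are the
  -- same.
  palindrome-Bext-lext-one : ∀ {w v} → Palindrome w → Card (Lext u w) 1 → Bext u w v → Pext u w v
  palindrome-Bext-lext-one pal L (a , b , refl , e∈)
    with refl ← card-one L (init-language {b} e∈) (to (palindrome-Rext⇔Lext pal b) (tail-language e∈)) =
    a , refl , e∈

  count-palindrome : ∀ {w b r l p} → (Bispecial u w → OrderCondition w) → Language u w → Palindrome w →
    Card (Bext u w) b → Card (Rext u w) r → Card (Lext u w) l → Card (Pext u w) p → b + 2 ≡ p + (r + l)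
  count-palindrome {w} {b} {r} {l} {p} cond w∈ pal B R L P
    with refl ← card-unique (card-resp (palindrome-Rext⇔Lext pal) R) L
    with 2 ≤? l
  ... | yes 2≤l = to (order⇔count b l l p)
    (proj₂ (cond (w∈ , (l , L , 2≤l) , (l , R , 2≤l))) pal _ p (b , l , l , B , R , L , refl) P)
  ... | no 2≰l
    with refl ← 1≤∧≱2⇒≡1 (card-inhabited (proj₂ (extendˡ w∈)) L) 2≰l
    with refl ← card-unique B (Bext-card-lext-one w∈ L R)
    with refl ← card-unique P (card-resp (λ v → mk⇔ (palindrome-Bext-lext-one pal L) (λ { (a , eq , e∈) → a , a , eq , e∈ })) B) = refl

  -- The cardinalities exist only up to double negation, but acyclicity of a finite list of arcs is
  -- decidable and therefore stable.
  order⇒acyclic : ∀ {N} → (∀ w → Bispecial u w → OrderCondition w) → Mirroring N →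
    ∀ i w → length w ≡ N → class N (suc i) ≡ canonical w → Language u w →
    ∀ n → Walk.Acyclic N i (Walk.arcs N i n)
  order⇒acyclic {N} cond mirroring i w refl at-i w∈ n = decidable-stable (acyclic? (arcs n)) λ ¬ac →
    ¬¬-bilateralOrder u w λ { (_ , b , r , l , B , R , L , _) →
    ¬¬-card {P = Pext u w} (map (λ a → a ∷ (w ∷ʳ a)) (allFin k))
      (λ { (a , refl , _) → ∈-map⁺ _ (∈-allFin a) }) λ (p , P) →
    ¬ac (all B R L P (w ≟ʷ reverse w) n) }
    where
    open Walk N i
    open Local w
    all : ∀ {b r l p} → Card (Bext u w) b → Card (Rext u w) r → Card (Lext u w) l → Card (Pext u w) p →
      Dec (Palindrome w) → ∀ n → Acyclic (arcs n)
    all B R L P (no ¬pal) = to (acyclic-nonpalindrome i at-i ¬pal mirroring B R L)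
      (count-nonpalindrome (cond w) w∈ ¬pal B R L)
    all B R L P (yes pal) = to (acyclic-palindrome i at-i pal mirroring B R L P)
      (count-palindrome (cond w) w∈ pal B R L P)

  order⇒mirroring : (∀ w → Bispecial u w → OrderCondition w) → ∀ N → Mirroring N
  order⇒mirroring cond zero    = mirroring-zero
  order⇒mirroring cond (suc N) = mirroring-suc N ih λ i →
    order⇒acyclic cond ih i (factor (suc i) N) (length-factor (suc i) N) refl (factor-language (suc i) N)
    where
    ih = order⇒mirroring cond N

theorem11 : ∀ (k : ℕ) (u : InfiniteWord k) → ClosedUnderReversal u →
    Rich u ⇔
    (∀ w → Bispecial u w →
    (¬ Palindrome w → ∀ z → BilateralOrder u w z → z ≡ 0ℤ) ×
    (Palindrome w → ∀ z p → BilateralOrder u w z → Card (Pext u w) p → z ≡ + p - 1ℤ))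
theorem11 k u closed = mk⇔
  (λ rich w (w∈ , _) → mirroring⇒order (to rich⇔mirroring rich) w w∈)
  (from rich⇔mirroring ∘ order⇒mirroring)
  where open Characterisation u closed
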